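{- Suppose that the alphabet $\Sigma$ and the length $n$ of the strings $A, B \in \Sigma^n$ are known to both Alice and Bob. Then there exists a (Monte-Carlo) randomized public-coin protocol which solves the problem "Hamming distance with non self-referencing LZ77" (Alice holds $\mathsf{LZN}(A)$, Bob holds $\mathsf{LZN}(B)$, and both must obtain $\mathsf{d_H}(A,B)$) with communication complexity $$\langle O(d \log \mathsf{zn}(A)),\ O(d \log \ell_{\max}) \rangle,$$ where $d = \mathsf{d_H}(A,B)$, $1 \le i_1 < \cdots < i_d \le n$ are the mismatching positions of $A$ and $B$ (the positions $i$ with $A[i] \ne B[i]$), and $\ell_{\max} = \max_{1 < k \leq d} \{i_{k} - i_{k-1}+1\}$.
   Context: Strings are indexed from $1$; $S[i..j]$ is the substring from position $i$ to $j$ (empty if $j<i$), and $S[i..]=S[i..|S|]$. $\mathsf{lcp}(X,Y)$ is the length of the longest common prefix of $X$ and $Y$. $\mathsf{d_H}(X,Y)=|\{i : X[i]\ne Y[i]\}|$ for $|X|=|Y|$. Non self-referencing LZ77 factorization: $\mathsf{LZN}(S)$ is the factorization $S=f_1\cdots f_{z}$ defined greedily from left to right as follows. Let $u_i=|f_1\cdots f_{i-1}|+1$ and let $p_i=\max_{1\le j<u_i}\mathsf{lcp}(S[u_i..],S[j..u_i-1])$ (with $p_i=0$ if $i=1$). Then $f_i=S[u_i..\min\{u_i+p_i,|S|\}]$. That is, $f_i$ is a fresh letter or the shortest prefix of $S[u_i..]$ with no occurrence inside $S[1..u_i-1]$ (or all of $S[u_i..]$ if that occurs in $S[1..u_i-1]$).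 The size $\mathsf{zn}(S)$ is the number $z$ of factors. Each factor is encoded by a triple consisting of the position of a (left-most) previous occurrence, a length, and the last character of the factor; thus $\mathsf{LZN}(S)$ determines $S$. Communication model (Yao; Bille et al.): Alice and Bob each hold their own input and exchange bits following a specified protocol in order to jointly compute a function of the two inputs; local computation is free. Communication complexity $\langle r,b\rangle$ means that $r$ communication rounds are used and a total of $b$ bits is exchanged. In a Monte-Carlo randomized public-coin protocol both parties access a shared infinite sequence of independent random coin tosses, and for every pair of inputs the output must be correct with probability at least $1-\epsilon$ for some constant $0<\epsilon<1/2$. Conventions: It is assumed that $A[1]\neq B[1]$ and $A[n]\ne B[n]$; otherwise $A$ and $B$ are replaced by $\#A\$$ and $\$B\#$ with two new distinct symbols $\#,\$$ (and $2$ is subtracted from the computed distance), and all quantities $n,d,i_k,\ell_{\max},\mathsf{zn}(A)$ refer to the padded strings. Inside $O(\cdot)$, $\log x$ is read as $\max\{1,\log_2 x\}$ (and as $1$ if $x=0$), and a maximum over the empty set is read as $1$. The constants hidden in $O(\cdot)$ are absolute (possibly depending on $\epsilon$). -}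

module Defs where

open import Data.Bool.Base using (Bool; true; false; if_then_else_)
open import Data.Empty using (⊥)
open import Data.Fin.Base using (Fin; zero; suc; toℕ)
open import Data.Fin.Properties using (+↔⊎) renaming (_≟_ to _≟ᶠ_)
open import Data.Integer.Base using (+_)
open import Data.List.Base as List
  using (List; []; _∷_; _++_; map; foldr; filter; tails; derun; allFin)
open import Data.List.NonEmpty.Base as List⁺ using (List⁺; _∷_)
open import Data.Nat.Base using (ℕ; zero; suc; _+_; _*_; _∸_; _^_; _⊔_; _≤_; _<_)
open import Data.Nat.Logarithm using (⌈log₂_⌉)
open import Data.Nat.Properties using (m^n≢0) renaming (_≟_ to _≟ⁿ_)
open import Data.Product.Base using (_×_; _,_; proj₁; proj₂; ∃-syntax)
open import Data.Rational.Base as ℚ using (ℚ)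
open import Data.Sum.Base using (_⊎_; inj₁; inj₂)
open import Data.Sum.Function.Propositional using (_⊎-↔_)
open import Data.Vec.Base as Vec using (Vec; []; _∷_; lookup; _∷ʳ_; toList)
open import Function.Base using (_∘_)
open import Function.Bundles using (_↔_)
open import Function.Construct.Composition using (_↔-∘_)
open import Function.Construct.Identity using (↔-id)
open import Function.Construct.Symmetry using (↔-sym)
open import Function.Properties.Inverse using (↔⇒↣)
open import Relation.Binary.Definitions using (DecidableEquality)
open import Relation.Binary.PropositionalEquality using (_≡_; _≢_; refl)
open import Relation.Nullary.Decidable
  using (Dec; yes; no; does; ¬?; _×-dec_; via-injection)

------------------------------------------------------------------------
-- Strings

record Alphabet : Set₁ where
  field
    Letter      : Set
    size        : ℕ
    enumeration : Letter ↔ Fin size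

  _≟_ : DecidableEquality Letter
  _≟_ = via-injection (↔⇒↣ enumeration) _≟ᶠ_

open Alphabet using (Letter)

Word : Alphabet → ℕ → Set
Word Σ n = Vec (Letter Σ) n

gaps : List ℕ → List ℕ
gaps []           = []
gaps (_ ∷ [])     = []
gaps (i ∷ j ∷ is) = (j ∸ i + 1) ∷ gaps (j ∷ is)

module _ (Σ : Alphabet) where
  open Alphabet Σ using (_≟_)

  -- i₁ < … < i_d, as elements of Fin n: the numbering starts at 0, which
  -- changes neither their number nor their differences.
  mismatches : ∀ {n} → Word Σ n → Word Σ n → List (Fin n)
  mismatches {n} A B = filter (λ i → ¬? (lookup A i ≟ lookup B i)) (allFin n)

  dH : ∀ {n} → Word Σ n → Word Σ n → ℕ
  dH A B = List.length (mismatches A B)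

  -- Every gap is at least 2, so the 1 only matters if there are no gaps.
  ℓmax : ∀ {n} → Word Σ n → Word Σ n → ℕ
  ℓmax A B = foldr _⊔_ 1 (gaps (map toℕ (mismatches A B)))

------------------------------------------------------------------------
-- Non self-referencing LZ77

record Triple (X : Set) : Set where
  constructor triple
  field
    source : ℕ
    copied : ℕ
    final  : X

Encoding : Alphabet → Set
Encoding Σ = List (Triple (Letter Σ))

module _ (Σ : Alphabet) where
  open Alphabet Σ using (_≟_)

  lcp : List (Letter Σ) → List (Letter Σ) → ℕ
  lcp (x ∷ xs) (y ∷ ys) = if does (x ≟ y) then suc (lcp xs ys) else 0
  lcp _        _        = 0

  -- For seen = S[1..u-1] and rest = S[u..], the tails of seen are the
  -- strings S[j..u-1], 1 ≤ j < u, and the empty string, which adds only a 0.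
  longestPrevious : (seen rest : List (Letter Σ)) → ℕ
  longestPrevious seen rest = foldr _⊔_ 0 (map (lcp rest) (tails seen))

  -- The first argument bounds the number of factors.
  factorsFrom : ℕ → (seen rest : List (Letter Σ)) → List (List⁺ (Letter Σ))
  factorsFrom zero    _    _        = []
  factorsFrom (suc _) _    []       = []
  factorsFrom (suc k) seen (c ∷ cs) =
    (c ∷ List.take p cs) ∷ factorsFrom k (seen ++ c ∷ List.take p cs) (List.drop p cs)
    where p = longestPrevious seen (c ∷ cs)

  factors : ∀ {n} → Word Σ n → List (List⁺ (Letter Σ))
  factors {n} S = factorsFrom n [] (toList S)

  zn : ∀ {n} → Word Σ n → ℕ
  zn S = List.length (factors S)

  -- The position, counted from 1, of the leftmost occurrence of w in s,
  -- provided that there is one; the empty string occurs at position 1.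
  leftmost : (w s : List (Letter Σ)) → ℕ
  leftmost w []       = 1
  leftmost w (c ∷ cs) =
    if does (lcp w (c ∷ cs) ≟ⁿ List.length w) then 1 else suc (leftmost w cs)

  -- A factor is a string of length `copied` that occurs in seen at position
  -- `source`, followed by the letter `final`.  This also covers a last factor
  -- which occurs in seen as a whole.
  encode : (seen : List (Letter Σ)) → List (List⁺ (Letter Σ)) → Encoding Σ
  encode seen []       = []
  encode seen (f ∷ fs) =
    triple (leftmost (List.take k w) seen) k (List⁺.last f) ∷ encode (seen ++ w) fs
    where
    w = List⁺.toList f
    k = List⁺.length f ∸ 1

  LZN : ∀ {n} → Word Σ n → Encoding Σ
  LZN S = encode [] (factors S)

------------------------------------------------------------------------
-- Padding

padded : Alphabet → Alphabet
padded Σ = record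
  { Letter      = Letter Σ ⊎ Fin 2
  ; size        = Alphabet.size Σ + 2
  ; enumeration = ↔-sym +↔⊎ ↔-∘ (Alphabet.enumeration Σ ⊎-↔ ↔-id (Fin 2))
  }

module _ (Σ : Alphabet) where
  open Alphabet Σ using (_≟_)

  hash dollar : Letter (padded Σ)
  hash   = inj₂ zero
  dollar = inj₂ (suc zero)

  padA padB : ∀ {n} → Word Σ n → Word (padded Σ) (suc (suc n))
  padA A = hash   ∷ (Vec.map inj₁ A ∷ʳ dollar)
  padB B = dollar ∷ (Vec.map inj₁ B ∷ʳ hash)

  EndsDiffer : ∀ {n} → Word Σ n → Word Σ n → Set
  EndsDiffer {zero}  _ _ = ⊥
  EndsDiffer {suc _} A B = Vec.head A ≢ Vec.head B × Vec.last A ≢ Vec.last B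

  endsDiffer? : ∀ {n} (A B : Word Σ n) → Dec (EndsDiffer A B)
  endsDiffer? {zero}  _ _ = no λ ()
  endsDiffer? {suc _} A B =
    ¬? (Vec.head A ≟ Vec.head B) ×-dec ¬? (Vec.last A ≟ Vec.last B)

  -- The value of Q on A and B, or on #A$ and $B# if padding is needed.
  normalised : (∀ Σ′ {m} → Word Σ′ m → Word Σ′ m → ℕ) → ∀ {n} → Word Σ n → Word Σ n → ℕ
  normalised Q A B with endsDiffer? A B
  ... | yes _ = Q Σ A B
  ... | no  _ = Q (padded Σ) (padA A) (padB B)

-- max{1, log₂ x} up to a factor of at most 2: if x ≥ 2, then
-- log₂ x ≤ ⌈log₂ x⌉ < log₂ x + 1 ≤ 2 log₂ x.
lg : ℕ → ℕ
lg x = 1 ⊔ ⌈log₂ x ⌉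

roundBound bitBound : ∀ Σ {n} → Word Σ n → Word Σ n → ℕ
roundBound Σ = normalised Σ λ Σ′ A B → dH Σ′ A B * lg (zn Σ′ A)
bitBound   Σ = normalised Σ λ Σ′ A B → dH Σ′ A B * lg (ℓmax Σ′ A B)

------------------------------------------------------------------------
-- Communication protocols

data Party : Set where
  alice bob : Party

_≟ᴾ_ : DecidableEquality Party
alice ≟ᴾ alice = yes refl
alice ≟ᴾ bob   = no λ ()
bob   ≟ᴾ alice = no λ ()
bob   ≟ᴾ bob   = yes refl

-- Deterministic protocols for inputs in X (Alice) and Y (Bob).  Each inner
-- node is one bit sent by the named party.  Who speaks next, and whether the
-- protocol has ended, is determined by the bits exchanged so far.
data Protocol (X Y Z : Set) : Set where
  output : (X → Z) → (Y → Z) → Protocol X Y Z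
  aliceSends : (X → Bool) → (Bool → Protocol X Y Z) → Protocol X Y Z
  bobSends   : (Y → Bool) → (Bool → Protocol X Y Z) → Protocol X Y Z

module _ {X Y Z : Set} where

  outputs : Protocol X Y Z → X → Y → Z × Z
  outputs (output f g)     x y = f x , g y
  outputs (aliceSends m π) x y = outputs (π (m x)) x y
  outputs (bobSends   m π) x y = outputs (π (m y)) x y

  senders : Protocol X Y Z → X → Y → List Party
  senders (output _ _)     x y = []
  senders (aliceSends m π) x y = alice ∷ senders (π (m x)) x y
  senders (bobSends   m π) x y = bob ∷ senders (π (m y)) x y

  bits : Protocol X Y Z → X → Y → ℕ
  bits π x y = List.length (senders π x y)

  -- A round is a maximal block of consecutive bits sent by the same party.
  rounds : Protocol X Y Z → X → Y → ℕ
  rounds π x y = List.length (derun _≟ᴾ_ (senders π x y))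

------------------------------------------------------------------------
-- Public coins

Coins : Set
Coins = ℕ → Bool

PublicCoinProtocol : (X Y Z : Set) → Set
PublicCoinProtocol X Y Z = Coins → Protocol X Y Z

DependsOnFirst : ℕ → (Coins → Bool) → Set
DependsOnFirst m E = ∀ ω ω′ → (∀ i → i < m → ω i ≡ ω′ i) → E ω ≡ E ω′

prepend : ∀ {m} → Vec Bool m → Coins → Coins
prepend []      ω         = ω
prepend (b ∷ _) ω zero    = b
prepend (_ ∷ w) ω (suc i) = prepend w ω i

count : ∀ m → (Vec Bool m → Bool) → ℕ
count zero    E = if E [] then 1 else 0
count (suc m) E = count m (E ∘ (false ∷_)) + count m (E ∘ (true ∷_))

frequency : ℕ → (Coins → Bool) → ℚ
frequency m E = (+ count m λ w → E (prepend w λ _ → false)) ℚ./ (2 ^ m)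
  where instance _ = m^n≢0 2 m

-- Pr[E] ≥ q for independent fair coins.  The event has to be decided by
-- finitely many coins; its probability is then the fraction of the
-- sequences of m coins for which it occurs, for any sufficiently large m.
Pr[_]≥_ : (Coins → Bool) → ℚ → Set
Pr[ E ]≥ q = ∃[ m ] DependsOnFirst m E × q ℚ.≤ frequency m E

-- Both parties output v.
Returns : ∀ {X Y} → PublicCoinProtocol X Y ℕ → X → Y → ℕ → Coins → Bool
Returns π x y v ω = does ((proj₁ out ≟ⁿ v) ×-dec (proj₂ out ≟ⁿ v))
  where out = outputs (π ω) x y

module Submission where

-- Alice and Bob decode their words and hash every letter to one bit, in a series
-- of planes with independent public hash functions; a mismatch shows in each
-- plane with probability 1/2.  In a plane Alice sends a random fingerprint of her
-- bit string, and Bob looks for a string with this fingerprint within distance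
-- w = 2ⁱ of his own and reports the positions where they differ.  There are
-- 2 ^ O(w log(2n/w)) candidates, so messages of O(w log(2n/w)) bits suffice.
-- If there is no candidate, then certainly more than w letters differ; hence
-- doubling w until T planes succeed gives w ≤ max (1, 2 d) for all coins, whereas
-- d = O(w) with high probability.  From then on every T planes leave, by Markov's
-- inequality, at most half of the undetected mismatches, and w may be halved too.
-- The costs form geometric series and add up to O(d) rounds and
-- O(d log (n/d) + d) bits, which is O(d log ℓmax) because n ≤ d ℓmax.

open import Defs
open import Data.Bool.Base using (Bool; true; false; not; _∧_; _∨_; _xor_; if_then_else_)
open import Data.Bool.Properties using () renaming (_≟_ to _≟ᵇ_)
open import Data.Fin.Base using (Fin; zero; suc; toℕ)
open import Data.Fin.Properties using (toℕ<n; toℕ-injective)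
import Data.Integer.Base as ℤ
import Data.Integer.Properties as ℤ
open import Data.List.Base as List
  using (List; []; _∷_; _++_; length; replicate; take; drop; tails; foldr; filter; derun)
open import Data.List.Membership.Propositional using (_∈_)
open import Data.List.Membership.Propositional.Properties using (∈-map⁺; ∈-++⁺ˡ; ∈-++⁺ʳ; ∈-++⁻)
open import Data.List.NonEmpty.Base as List⁺ using (List⁺; _∷_)
open import Data.List.Properties
  using (length-map; length-++; length-take; length-drop; length-replicate; take++drop≡id; take-take; take-all;
         ++-assoc; ++-identityʳ; filter-accept; filter-reject; derun-reject)
open import Data.List.Relation.Unary.Any using (here; there)
open import Data.Nat.Base
open import Data.Nat.Induction using (<-rec)
open import Data.Nat.Logarithm using (⌈log₂_⌉; ⌈log₂⌉-mono-≤; ⌈log₂⌈n/2⌉⌉≡⌈log₂n⌉∸1; ⌈log₂2^n⌉≡n)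
open import Data.Nat.Properties renaming (_≟_ to _≟ⁿ_)
open import Data.Nat.Tactic.RingSolver using (solve-∀)
open import Data.Product.Base using (∃; ∃-syntax; Σ-syntax; _×_; _,_; proj₁; proj₂)
open import Data.Rational.Base as ℚ using (ℚ; mkℚ; 0ℚ; 1ℚ; ½; _-_) renaming (_<_ to _<ℚ_)
import Data.Rational.Properties as ℚ
open import Data.Rational.Unnormalised.Base using (mkℚᵘ; *≤*)
import Data.Rational.Unnormalised.Properties as ℚᵘ
open import Data.Sum.Base using (_⊎_; inj₁; inj₂)
open import Data.Sum.Properties using (inj₁-injective)
open import Data.Vec.Base as Vec using (Vec; []; _∷_; zipWith; head; tail; toList; lookup; _∷ʳ_)
open import Data.Vec.Properties using (≡-dec; length-toList; last-∷ʳ)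
open import Data.Vec.Relation.Unary.All using (All; []; _∷_)
open import Function.Base using (_∘_; id; const)
open import Function.Bundles using (Inverse)
open import Relation.Binary.PropositionalEquality
open import Relation.Nullary.Decidable using (Dec; yes; no; does; ¬?; _×-dec_; dec-true; dec-false)
open import Relation.Nullary.Negation using (contradiction)

-- Powers of two and logarithms

-- Two kinds of randomness are kept apart. The letter hashes alone fix the ideal execution: what is
-- detected after each plane, which planes are too heavy, and where the doubling stops. The
-- fingerprint functions are independent of them. So for fixed letter hashes every comparison
-- concerns fixed strings, a union bound over the planes of the ideal execution is legitimate, and
-- the same fingerprint functions can serve in every plane. The bounds on rounds and bits have to
-- hold for all coins, also when the answer is wrong. Hence the doubling relies only on one-sided
-- facts: equal letters never hash differently, and the true difference, if light, is always a
-- candidate. The halving phase has no such certificate, so its length is fixed by the level at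
-- which the doubling stopped, and an overfull plane there aborts the run. A constant error per
-- plane would accumulate over the levels. The additional `σ * 2 ^ i` bits of a fingerprint make the
-- error decay at least geometrically in the level, and they lengthen the messages by a constant
-- factor only.

1+m≤2^m : ∀ m → 1 + m ≤ 2 ^ m
1+m≤2^m zero    = ≤-refl
1+m≤2^m (suc m) = begin
  1 + (1 + m)   ≤⟨ +-mono-≤ (m^n>0 2 m) (1+m≤2^m m) ⟩
  2 ^ m + 2 ^ m ≡⟨ cong (2 ^ m +_) (sym (+-identityʳ _)) ⟩
  2 ^ suc m     ∎
  where open ≤-Reasoning

m≤2^m : ∀ m → m ≤ 2 ^ m
m≤2^m m = ≤-trans (n≤1+n m) (1+m≤2^m m)

n≤2^⌈log₂n⌉ : ∀ n → n ≤ 2 ^ ⌈log₂ n ⌉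
n≤2^⌈log₂n⌉ = <-rec _ step
  where
  open ≤-Reasoning

  n≤2*⌈n/2⌉ : ∀ n → n ≤ 2 * ⌈ n /2⌉
  n≤2*⌈n/2⌉ n = begin
    n                       ≡⟨ ⌊n/2⌋+⌈n/2⌉≡n n ⟨
    ⌊ n /2⌋ + ⌈ n /2⌉       ≤⟨ +-mono-≤ (⌊n/2⌋≤⌈n/2⌉ n) (≤-reflexive (sym (+-identityʳ _))) ⟩
    ⌈ n /2⌉ + (⌈ n /2⌉ + 0) ∎

  step : ∀ n → (∀ {m} → m < n → m ≤ 2 ^ ⌈log₂ m ⌉) → n ≤ 2 ^ ⌈log₂ n ⌉
  step 0 _ = z≤n
  step 1 _ = ≤-refl
  step n@(suc (suc n′)) rec = begin
    n                             ≤⟨ n≤2*⌈n/2⌉ n ⟩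
    2 * ⌈ n /2⌉                   ≤⟨ *-monoʳ-≤ 2 (rec (⌈n/2⌉<n n′)) ⟩
    2 ^ suc ⌈log₂ ⌈ n /2⌉ ⌉       ≡⟨ cong (λ k → 2 ^ suc k) (⌈log₂⌈n/2⌉⌉≡⌈log₂n⌉∸1 n) ⟩
    2 ^ suc (⌈log₂ n ⌉ ∸ 1)       ∎

2^⌈log₂n⌉≤2n : ∀ n → 1 ≤ n → 2 ^ ⌈log₂ n ⌉ ≤ 2 * n
2^⌈log₂n⌉≤2n n 1≤n with bracket n 1≤n
  where
  -- Any power of two between n and 2 n will do, because the rounded logarithm of n is at most its
  -- exponent.
  bracket : ∀ n → 1 ≤ n → ∃[ k ] n ≤ 2 ^ k × 2 ^ k ≤ 2 * n
  bracket 1 _ = 0 , ≤-refl , s≤s z≤n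
  bracket (suc n@(suc _)) _ with bracket n (s≤s z≤n)
  ... | k , n≤ , ≤2n with suc n ≤? 2 ^ k
  ...   | yes 1+n≤ = k , 1+n≤ , ≤-trans ≤2n (*-monoʳ-≤ 2 (n≤1+n n))
  ...   | no  1+n≰ = suc k
                   , +-mono-≤ (m^n>0 2 k) (≤-trans n≤ (m≤m+n (2 ^ k) 0))
                   , *-monoʳ-≤ 2 (<⇒≤ (≰⇒> 1+n≰))
... | k , n≤2^k , 2^k≤2n = ≤-trans (^-monoʳ-≤ 2 (subst (⌈log₂ n ⌉ ≤_) (⌈log₂2^n⌉≡n k) (⌈log₂⌉-mono-≤ n≤2^k))) 2^k≤2n

∑< : ℕ → (ℕ → ℕ) → ℕ
∑< zero    f = 0
∑< (suc n) f = f n + ∑< n f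

-- s ≤ (1 - 1/2ᵏ) y, without subtraction, is preserved by adding at most y/2ᵏ⁺¹.
geometric-step : ∀ k s x y → x * 2 ^ suc k ≤ y → s * 2 ^ k + y ≤ 2 ^ k * y →
                 (x + s) * 2 ^ suc k + y ≤ 2 ^ suc k * y
geometric-step k s x y x≤ s≤ = begin
  (x + s) * 2 ^ suc k + y               ≡⟨ regroup x s (2 ^ k) y ⟩
  x * 2 ^ suc k + (2 * (s * 2 ^ k) + y) ≤⟨ +-monoˡ-≤ _ x≤ ⟩
  y + (2 * (s * 2 ^ k) + y)             ≡⟨ double (s * 2 ^ k) y ⟩
  2 * (s * 2 ^ k + y)                   ≤⟨ *-monoʳ-≤ 2 s≤ ⟩
  2 * (2 ^ k * y)                       ≡⟨ *-assoc 2 (2 ^ k) y ⟨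
  2 ^ suc k * y                         ∎
  where
  open ≤-Reasoning
  regroup : ∀ a b c y → (a + b) * (2 * c) + y ≡ a * (2 * c) + (2 * (b * c) + y)
  regroup = solve-∀
  double : ∀ a y → y + (2 * a + y) ≡ 2 * (a + y)
  double = solve-∀

geometric-start : ∀ k s y → s * 2 ^ k + y ≤ 2 ^ k * y → s ≤ y
geometric-start k s y s≤ = *-cancelʳ-≤ _ _ (2 ^ k) {{m^n≢0 2 k}}
  (≤-trans (m≤m+n _ y) (≤-trans s≤ (≤-reflexive (*-comm (2 ^ k) y))))

∑<-geometric : ∀ n (f : ℕ → ℕ) {y} → (∀ i → i < n → f i * 2 ^ suc i ≤ y) → ∑< n f ≤ y
∑<-geometric n f {y} f≤ = geometric-start n _ y (go n ≤-refl)
  where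
  go : ∀ k → k ≤ n → ∑< k f * 2 ^ k + y ≤ 2 ^ k * y
  go zero    _   = m≤m+n y 0
  go (suc k) k<n = geometric-step k (∑< k f) (f k) y (f≤ k k<n) (go k (<⇒≤ k<n))

-- Summation over finite sets, and random tables

bit : Bool → ℕ
bit b = if b then 1 else 0

bit≤1 : ∀ b → bit b ≤ 1
bit≤1 false = z≤n
bit≤1 true  = ≤-refl

-- Serves as an unnormalised expectation over a uniform element of A. Probability bounds take the
-- form `∑ S f * 2 ^ k ≤ card S`, which keeps all estimates within the natural numbers until the
-- very end.
record Summation (A : Set) : Set where
  field
    ∑      : (A → ℕ) → ℕ
    ∑-mono : ∀ {f g} → (∀ a → f a ≤ g a) → ∑ f ≤ ∑ g
    ∑-+    : ∀ f g → ∑ (λ a → f a + g a) ≡ ∑ f + ∑ g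
    ∑-*    : ∀ c f → ∑ (λ a → c * f a) ≡ c * ∑ f
    ∑-term : ∀ f a → f a ≤ ∑ f

  card : ℕ
  card = ∑ (const 1)

  ∑-cong : ∀ {f g} → (∀ a → f a ≡ g a) → ∑ f ≡ ∑ g
  ∑-cong f≡g = ≤-antisym (∑-mono (≤-reflexive ∘ f≡g)) (∑-mono (≤-reflexive ∘ sym ∘ f≡g))

  ∑-*ʳ : ∀ f c → ∑ (λ a → f a * c) ≡ ∑ f * c
  ∑-*ʳ f c = trans (∑-cong (λ a → *-comm (f a) c)) (trans (∑-* c f) (*-comm c _))

  ∑-const : ∀ c → ∑ (const c) ≡ c * card
  ∑-const c = trans (∑-cong (λ _ → sym (*-identityʳ c))) (∑-* c (const 1))

open Summation

overBool : Summation Bool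
overBool = record
  { ∑      = λ f → f false + f true
  ; ∑-mono = λ f≤g → +-mono-≤ (f≤g false) (f≤g true)
  ; ∑-+    = λ f g → lemma (f false) (f true) (g false) (g true)
  ; ∑-*    = λ c f → sym (*-distribˡ-+ c (f false) (f true))
  ; ∑-term = λ { f false → m≤m+n _ _ ; f true → m≤n+m _ _ }
  }
  where
  lemma : ∀ a b c d → (a + c) + (b + d) ≡ (a + b) + (c + d)
  lemma = solve-∀

module _ {A : Set} (S : Summation A) where

  overVec : ∀ n → Summation (Vec A n)
  overVec zero = record
    { ∑      = λ f → f []
    ; ∑-mono = λ f≤g → f≤g []
    ; ∑-+    = λ _ _ → refl
    ; ∑-*    = λ _ _ → refl
    ; ∑-term = λ { f [] → ≤-refl }
    }
  overVec (suc n) = record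
    { ∑      = λ f → ∑ S λ a → ∑ (overVec n) λ v → f (a ∷ v)
    ; ∑-mono = λ f≤g → ∑-mono S λ a → ∑-mono (overVec n) λ v → f≤g (a ∷ v)
    ; ∑-+    = λ f g → trans (∑-cong S λ a → ∑-+ (overVec n) _ _) (∑-+ S _ _)
    ; ∑-*    = λ c f → trans (∑-cong S λ a → ∑-* (overVec n) c _) (∑-* S c _)
    ; ∑-term = λ { f (a ∷ v) → ≤-trans (∑-term (overVec n) (f ∘ (a ∷_)) v)
                                       (∑-term S (λ a → ∑ (overVec n) (f ∘ (a ∷_))) a) }
    }

overBits : ∀ n → Summation (Vec Bool n)
overBits = overVec overBool

∑-swap : ∀ {A} (S : Summation A) n (f : A → Vec Bool n → ℕ) →
         ∑ S (λ a → ∑ (overBits n) (f a)) ≡ ∑ (overBits n) (λ v → ∑ S (λ a → f a v))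
∑-swap S zero    f = refl
∑-swap S (suc n) f =
  trans (∑-+ S _ _) (cong₂ _+_ (∑-swap S n λ a v → f a (false ∷ v)) (∑-swap S n λ a v → f a (true ∷ v)))

card-overBits : ∀ n → card (overBits n) ≡ 2 ^ n
card-overBits zero    = refl
card-overBits (suc n) =
  trans (cong₂ _+_ (card-overBits n) (card-overBits n)) (cong (2 ^ n +_) (sym (+-identityʳ _)))

split : ∀ {A : Set} a {b} → Vec A (a + b) → Vec A a × Vec A b
split zero    v       = [] , v
split (suc a) (x ∷ v) = (x ∷ proj₁ (split a v)) , proj₂ (split a v)

∑-split : ∀ a {b} (f : Vec Bool a × Vec Bool b → ℕ) →
          ∑ (overBits (a + b)) (f ∘ split a) ≡ ∑ (overBits a) λ u → ∑ (overBits b) λ v → f (u , v)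
∑-split zero    f = refl
∑-split (suc a) f =
  cong₂ _+_ (∑-split a λ (u , v) → f ((false ∷ u) , v)) (∑-split a λ (u , v) → f ((true ∷ u) , v))

-- A row is the value table of one random function from the numbers below `columns` to bits.
-- Finitely many functions and arguments suffice for given n and alphabet, so a table consumes
-- finitely many coins.
Table : ℕ → ℕ → Set
Table rows columns = Vec (Vec Bool columns) rows

overTables : ∀ r c → Summation (Table r c)
overTables r c = overVec (overBits c) r

toTable : ∀ r {c} → Vec Bool (r * c) → Table r c
toTable zero        _ = []
toTable (suc r) {c} v = proj₁ (split c v) ∷ toTable r (proj₂ (split c v))

∑-toTable : ∀ r {c} (f : Table r c → ℕ) → ∑ (overBits (r * c)) (f ∘ toTable r) ≡ ∑ (overTables r c) f
∑-toTable zero        f = refl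
∑-toTable (suc r) {c} f =
  trans (∑-split c λ (u , v) → f (u ∷ toTable r v))
        (∑-cong (overBits c) λ u → ∑-toTable r (f ∘ (u ∷_)))

Functions : Set
Functions = ℕ → ℕ → Bool

_!_ : ∀ {n} → Vec Bool n → ℕ → Bool
[]      ! _     = false
(b ∷ _) ! zero  = b
(_ ∷ v) ! suc x = v ! x

functions : ∀ {r c} → Table r c → Functions
functions []      _       _ = false
functions (u ∷ _) zero    x = u ! x
functions (_ ∷ t) (suc k) x = functions t k x

_≡ᵇᵒ_ : Bool → Bool → Bool
a ≡ᵇᵒ b = not (a xor b)

agree : Functions → ℕ → ℕ → ℕ → Bool
agree ρ zero    x y = true
agree ρ (suc p) x y = (ρ p x ≡ᵇᵒ ρ p y) ∧ agree ρ p x y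

-- `agree` grows at its last function, as the planes do, whereas a table is built from its first
-- row. This reconciles the two orders.
agree-shift : ∀ ρ p x y → agree ρ (suc p) x y ≡ (ρ 0 x ≡ᵇᵒ ρ 0 y) ∧ agree (ρ ∘ suc) p x y
agree-shift ρ zero    x y = refl
agree-shift ρ (suc p) x y =
  trans (cong ((ρ (suc p) x ≡ᵇᵒ ρ (suc p) y) ∧_) (agree-shift ρ p x y))
        (∧-swap (ρ (suc p) x ≡ᵇᵒ ρ (suc p) y) (ρ 0 x ≡ᵇᵒ ρ 0 y) _)
  where
  ∧-swap : ∀ a b c → a ∧ (b ∧ c) ≡ b ∧ (a ∧ c)
  ∧-swap false false c = refl
  ∧-swap false true  c = refl
  ∧-swap true  b     c = refl

agree-refl : ∀ ρ p x → agree ρ p x x ≡ true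
agree-refl ρ zero    x = refl
agree-refl ρ (suc p) x with ρ p x
... | false = agree-refl ρ p x
... | true  = agree-refl ρ p x

bit-∧ : ∀ a b → bit (a ∧ b) ≡ bit a * bit b
bit-∧ false b = refl
bit-∧ true  b = sym (+-identityʳ _)

half : ∀ c (E₀ E₁ : Vec Bool c → Bool) → (∀ v → bit (E₀ v) + bit (E₁ v) ≡ 1) →
       (∑ (overBits c) (bit ∘ E₀) + ∑ (overBits c) (bit ∘ E₁)) * 2 ≡ card (overBits (suc c))
half c E₀ E₁ one = begin
  (∑ (overBits c) (bit ∘ E₀) + ∑ (overBits c) (bit ∘ E₁)) * 2 ≡⟨ cong (_* 2) (∑-+ (overBits c) _ _) ⟨
  ∑ (overBits c) (λ v → bit (E₀ v) + bit (E₁ v)) * 2          ≡⟨ cong (_* 2) (∑-cong (overBits c) one) ⟩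
  card (overBits c) * 2                                       ≡⟨ twice (card (overBits c)) ⟩
  card (overBits (suc c))                                     ∎
  where
  open ≡-Reasoning
  twice : ∀ k → k * 2 ≡ k + k
  twice = solve-∀

-- Once the smaller of the two columns is at the head, the other bit is drawn independently of it,
-- and exactly one value of the head bit agrees with it.
pair-collision : ∀ {c} x y → x < c → y < c → x ≢ y →
                 ∑ (overBits c) (λ u → bit ((u ! x) ≡ᵇᵒ (u ! y))) * 2 ≡ card (overBits c)
pair-collision {suc c} zero    zero    _ _ x≢y = contradiction refl x≢y
pair-collision {suc c} zero    (suc y) _ _ _   =
  half c (λ v → false ≡ᵇᵒ (v ! y)) (λ v → true ≡ᵇᵒ (v ! y)) λ v → one (v ! y)
  where
  one : ∀ b → bit (false ≡ᵇᵒ b) + bit (true ≡ᵇᵒ b) ≡ 1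
  one false = refl
  one true  = refl
pair-collision {suc c} (suc x) zero    _ _ _   =
  half c (λ v → (v ! x) ≡ᵇᵒ false) (λ v → (v ! x) ≡ᵇᵒ true) λ v → one (v ! x)
  where
  one : ∀ b → bit (b ≡ᵇᵒ false) + bit (b ≡ᵇᵒ true) ≡ 1
  one false = refl
  one true  = refl
pair-collision {suc c} (suc x) (suc y) (s≤s x<c) (s≤s y<c) x≢y =
  trans (*-distribʳ-+ 2 s s) (cong₂ _+_ ih ih)
  where
  s  = ∑ (overBits c) (λ u → bit ((u ! x) ≡ᵇᵒ (u ! y)))
  ih = pair-collision x y x<c y<c (x≢y ∘ cong suc)

-- The rows are independent, so the sum factorises and each of the first p rows contributes a factor
-- 1/2; the remaining rows are unconstrained.
collision : ∀ {r c} p {x y} → p ≤ r → x < c → y < c → x ≢ y →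
            ∑ (overTables r c) (λ t → bit (agree (functions t) p x y)) * 2 ^ p ≡ card (overTables r c)
collision             zero            p≤r       x<c y<c x≢y = *-identityʳ _
collision {suc r} {c} (suc p) {x} {y} (s≤s p≤r) x<c y<c x≢y = begin
  ∑ (overTables (suc r) c) (λ t → bit (agree (functions t) (suc p) x y)) * 2 ^ suc p
    ≡⟨ cong (_* 2 ^ suc p) (∑-cong (overBits c) λ u → trans (∑-cong (overTables r c) λ t →
         trans (cong bit (agree-shift (functions (u ∷ t)) p x y)) (bit-∧ ((u ! x) ≡ᵇᵒ (u ! y)) _))
         (∑-* (overTables r c) (first u) _)) ⟩
  ∑ (overBits c) (λ u → first u * rest) * 2 ^ suc p
    ≡⟨ cong (_* 2 ^ suc p) (∑-*ʳ (overBits c) first rest) ⟩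
  ∑ (overBits c) first * rest * (2 * 2 ^ p)
    ≡⟨ regroup (∑ (overBits c) first) rest (2 ^ p) ⟩
  (∑ (overBits c) first * 2) * (rest * 2 ^ p)
    ≡⟨ cong₂ _*_ (pair-collision x y x<c y<c x≢y) (collision p p≤r x<c y<c x≢y) ⟩
  card (overBits c) * card (overTables r c)
    ≡⟨ trans (*-comm (card (overBits c)) _) (sym (∑-const (overBits c) _)) ⟩
  card (overTables (suc r) c) ∎
  where
  open ≡-Reasoning
  first = λ (u : Vec Bool c) → bit ((u ! x) ≡ᵇᵒ (u ! y))
  rest  = ∑ (overTables r c) λ t → bit (agree (functions t) p x y)
  regroup : ∀ a b c → a * b * (2 * c) ≡ (a * 2) * (b * c)
  regroup = solve-∀

-- Codes for sets of few positions

weight : ∀ {n} → Vec Bool n → ℕ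
weight []      = 0
weight (b ∷ v) = bit b + weight v

weight≤n : ∀ {n} (v : Vec Bool n) → weight v ≤ n
weight≤n []      = z≤n
weight≤n (b ∷ v) = +-mono-≤ (bit≤1 b) (weight≤n v)

masks : ∀ n → ℕ → List (Vec Bool n)
masks zero    _       = [] ∷ []
masks (suc n) zero    = List.map (false ∷_) (masks n zero)
masks (suc n) (suc w) = List.map (false ∷_) (masks n (suc w)) ++ List.map (true ∷_) (masks n w)

∈-masks : ∀ {n} w (v : Vec Bool n) → weight v ≤ w → v ∈ masks n w
∈-masks w       []          _       = here refl
∈-masks zero    (false ∷ v) ≤w      = ∈-map⁺ (false ∷_) (∈-masks zero v ≤w)
∈-masks (suc w) (false ∷ v) ≤w      = ∈-++⁺ˡ (∈-map⁺ (false ∷_) (∈-masks (suc w) v ≤w))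
∈-masks (suc w) (true ∷ v)  (s≤s ≤w) = ∈-++⁺ʳ _ (∈-map⁺ (true ∷_) (∈-masks w v ≤w))

-- Comparison of coefficients in (1 + 1/ℓ) ^ n, multiplied by ℓ ^ n.
length-masks : ∀ ℓ .{{_ : NonZero ℓ}} n w → length (masks n w) * ℓ ^ n ≤ ℓ ^ w * suc ℓ ^ n
length-masks ℓ zero    w = *-monoˡ-≤ 1 (m^n>0 ℓ w)
length-masks ℓ (suc n) zero = begin
  length (List.map (false ∷_) (masks n 0)) * (ℓ * ℓ ^ n) ≡⟨ cong (_* (ℓ * ℓ ^ n)) (length-map _ (masks n 0)) ⟩
  length (masks n 0) * (ℓ * ℓ ^ n) ≡⟨ swap (length (masks n 0)) ℓ (ℓ ^ n) ⟩
  ℓ * (length (masks n 0) * ℓ ^ n) ≤⟨ *-mono-≤ (n≤1+n ℓ) (length-masks ℓ n 0) ⟩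
  suc ℓ * (1 * suc ℓ ^ n)          ≡⟨ swap (suc ℓ) 1 (suc ℓ ^ n) ⟩
  1 * (suc ℓ * suc ℓ ^ n)          ∎
  where
  open ≤-Reasoning
  swap : ∀ a b c → a * (b * c) ≡ b * (a * c)
  swap = solve-∀
length-masks ℓ (suc n) (suc w) = begin
  length (List.map (false ∷_) (masks n (suc w)) ++ List.map (true ∷_) (masks n w)) * (ℓ * ℓ ^ n)
    ≡⟨ cong (_* (ℓ * ℓ ^ n)) (trans (length-++ (List.map (false ∷_) (masks n (suc w))))
         (cong₂ _+_ (length-map _ (masks n (suc w))) (length-map _ (masks n w)))) ⟩
  (length (masks n (suc w)) + length (masks n w)) * (ℓ * ℓ ^ n)
    ≡⟨ regroup (length (masks n (suc w))) (length (masks n w)) ℓ (ℓ ^ n) ⟩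
  ℓ * (length (masks n (suc w)) * ℓ ^ n) + ℓ * (length (masks n w) * ℓ ^ n)
    ≤⟨ +-mono-≤ (*-monoʳ-≤ ℓ (length-masks ℓ n (suc w))) (*-monoʳ-≤ ℓ (length-masks ℓ n w)) ⟩
  ℓ * (ℓ * ℓ ^ w * suc ℓ ^ n) + ℓ * (ℓ ^ w * suc ℓ ^ n)
    ≡⟨ collect ℓ (ℓ ^ w) (suc ℓ ^ n) ⟩
  ℓ * ℓ ^ w * (suc ℓ * suc ℓ ^ n) ∎
  where
  open ≤-Reasoning
  regroup : ∀ a b c d → (a + b) * (c * d) ≡ c * (a * d) + c * (b * d)
  regroup = solve-∀
  collect : ∀ l a b → l * (l * a * b) + l * (a * b) ≡ l * a * (suc l * b)
  collect = solve-∀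

-- (1 + 1/ℓ) ^ h ≤ 1 / (1 - h/ℓ), which is 2 for h = ℓ/2.
[1+ℓ]^h≤2ℓ^h : ∀ h → suc (2 * h) ^ h ≤ 2 * (2 * h) ^ h
[1+ℓ]^h≤2ℓ^h zero      = s≤s z≤n
[1+ℓ]^h≤2ℓ^h h@(suc _) = *-cancelʳ-≤ _ _ h (begin
  suc ℓ ^ h * h       ≡⟨ cong (suc ℓ ^ h *_) (sym (trans (cong (_∸ h) (cong (h +_) (+-identityʳ h))) (m+n∸m≡n h h))) ⟩
  suc ℓ ^ h * (ℓ ∸ h) ≤⟨ go h (m≤m+n h _) ⟩
  ℓ * ℓ ^ h           ≡⟨ swap h (ℓ ^ h) ⟩
  2 * ℓ ^ h * h       ∎)
  where
  open ≤-Reasoning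
  ℓ = 2 * h
  swap : ∀ h x → 2 * h * x ≡ 2 * x * h
  swap = solve-∀
  go : ∀ k → k ≤ ℓ → suc ℓ ^ k * (ℓ ∸ k) ≤ ℓ * ℓ ^ k
  go zero    _   = ≤-reflexive (trans (*-identityˡ ℓ) (sym (*-identityʳ ℓ)))
  go (suc k) k<ℓ = begin
    suc ℓ * suc ℓ ^ k * (ℓ ∸ suc k)     ≡⟨ rearr (suc ℓ) (suc ℓ ^ k) (ℓ ∸ suc k) ⟩
    suc ℓ ^ k * (suc ℓ * (ℓ ∸ suc k))   ≤⟨ *-monoʳ-≤ (suc ℓ ^ k) step ⟩
    suc ℓ ^ k * (ℓ * (ℓ ∸ k))           ≡⟨ rearr ℓ (suc ℓ ^ k) (ℓ ∸ k) ⟨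
    ℓ * suc ℓ ^ k * (ℓ ∸ k)             ≡⟨ *-assoc ℓ (suc ℓ ^ k) _ ⟩
    ℓ * (suc ℓ ^ k * (ℓ ∸ k))           ≤⟨ *-monoʳ-≤ ℓ (go k (<⇒≤ k<ℓ)) ⟩
    ℓ * (ℓ * ℓ ^ k)                     ∎
    where
    rearr : ∀ a b c → a * b * c ≡ b * (a * c)
    rearr = solve-∀
    step : suc ℓ * (ℓ ∸ suc k) ≤ ℓ * (ℓ ∸ k)
    step = begin
      suc ℓ * (ℓ ∸ suc k)         ≤⟨ +-monoˡ-≤ _ (m∸n≤m ℓ (suc k)) ⟩
      ℓ + ℓ * (ℓ ∸ suc k)         ≡⟨ *-suc ℓ (ℓ ∸ suc k) ⟨
      ℓ * suc (ℓ ∸ suc k)         ≡⟨ cong (ℓ *_) (sym (+-∸-assoc 1 k<ℓ)) ⟩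
      ℓ * (ℓ ∸ k)                 ∎

-- With ℓ = 2 h, the bound ℓ ^ w (1 + 1/ℓ) ^ n is at most ℓ ^ w ((1 + 1/ℓ) ^ h) ^ w, because n ≤ h
-- w. The inner power is at most 2, which leaves (2 ℓ) ^ w.
length-masks≤ : ∀ h .{{_ : NonZero h}} n w → n ≤ h * w → length (masks n w) ≤ (4 * h) ^ w
length-masks≤ h n w n≤hw = *-cancelʳ-≤ _ _ (ℓ ^ (h * w)) (begin
  length (masks n w) * ℓ ^ (h * w)           ≡⟨ cong (length (masks n w) *_) (split-power ℓ) ⟩
  length (masks n w) * (ℓ ^ n * ℓ ^ k)       ≡⟨ *-assoc (length (masks n w)) _ _ ⟨
  length (masks n w) * ℓ ^ n * ℓ ^ k         ≤⟨ *-mono-≤ (length-masks ℓ n w) (^-monoˡ-≤ k (n≤1+n ℓ)) ⟩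
  ℓ ^ w * suc ℓ ^ n * suc ℓ ^ k              ≡⟨ *-assoc (ℓ ^ w) _ _ ⟩
  ℓ ^ w * (suc ℓ ^ n * suc ℓ ^ k)            ≡⟨ cong (ℓ ^ w *_)
      (trans (sym (split-power (suc ℓ))) (sym (^-*-assoc (suc ℓ) h w))) ⟩
  ℓ ^ w * (suc ℓ ^ h) ^ w                    ≤⟨ *-monoʳ-≤ (ℓ ^ w) (^-monoˡ-≤ w ([1+ℓ]^h≤2ℓ^h h)) ⟩
  ℓ ^ w * (2 * ℓ ^ h) ^ w                    ≡⟨ cong (ℓ ^ w *_)
      (trans (^-distribʳ-* w 2 (ℓ ^ h)) (cong (2 ^ w *_) (^-*-assoc ℓ h w))) ⟩
  ℓ ^ w * (2 ^ w * ℓ ^ (h * w))              ≡⟨ *-assoc (ℓ ^ w) _ _ ⟨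
  ℓ ^ w * 2 ^ w * ℓ ^ (h * w)                ≡⟨ cong (_* ℓ ^ (h * w))
      (trans (sym (^-distribʳ-* w ℓ 2)) (cong (_^ w) (four h))) ⟩
  (4 * h) ^ w * ℓ ^ (h * w)                  ∎)
  where
  open ≤-Reasoning
  ℓ = 2 * h
  instance
    ℓ≢0 : NonZero ℓ
    ℓ≢0 = m*n≢0 2 h
    power≢0 : NonZero (ℓ ^ (h * w))
    power≢0 = m^n≢0 ℓ (h * w)
  k = h * w ∸ n
  split-power : ∀ b → b ^ (h * w) ≡ b ^ n * b ^ k
  split-power b = trans (cong (b ^_) (sym (m+[n∸m]≡n n≤hw))) (^-distribˡ-+-* b n k)
  four : ∀ h → 2 * h * 2 ≡ 4 * h
  four = solve-∀
  ^-distribʳ-* : ∀ w a b → (a * b) ^ w ≡ a ^ w * b ^ w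
  ^-distribʳ-* zero    a b = refl
  ^-distribʳ-* (suc w) a b =
    trans (cong (a * b *_) (^-distribʳ-* w a b)) ([m*n]*[o*p]≡[m*o]*[n*p] a b (a ^ w) (b ^ w))

-- The bits steer a binary search. Codes that point beyond the end of the list yield the default;
-- the encoding only has to be surjective.
pick : ∀ {A : Set} → A → ∀ k → List A → Vec Bool k → A
pick a zero    []       [] = a
pick a zero    (x ∷ _)  [] = x
pick a (suc k) xs (false ∷ c) = pick a k (List.take (2 ^ k) xs) c
pick a (suc k) xs (true  ∷ c) = pick a k (List.drop (2 ^ k) xs) c

pick-surjective : ∀ {A : Set} (a : A) k xs {x} → length xs ≤ 2 ^ k → x ∈ xs → ∃[ c ] pick a k xs c ≡ x
pick-surjective a zero    (x ∷ [])     _  (here refl) = [] , refl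
pick-surjective a zero    (x ∷ _ ∷ xs) (s≤s ()) _
pick-surjective a (suc k) xs {x} xs≤ x∈ with ∈-++⁻ (List.take (2 ^ k) xs)
    (subst (x ∈_) (sym (take++drop≡id (2 ^ k) xs)) x∈)
... | inj₁ x∈take = let c , eq = pick-surjective a k _ (≤-trans (≤-reflexive (length-take (2 ^ k) xs)) (m⊓n≤m _ _)) x∈take
                    in false ∷ c , eq
... | inj₂ x∈drop = let c , eq = pick-surjective a k _ drop≤ x∈drop in true ∷ c , eq
  where
  drop≤ : length (List.drop (2 ^ k) xs) ≤ 2 ^ k
  drop≤ = ≤-trans (≤-reflexive (length-drop (2 ^ k) xs))
                  (m≤n+o⇒m∸n≤o _ (2 ^ k) (subst (length xs ≤_) (cong (2 ^ k +_) (+-identityʳ _)) xs≤))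

search : ∀ k {P : Vec Bool k → Set} → (∀ c → Dec (P c)) → Dec (∃ P)
search zero    P? with P? []
... | yes p = yes ([] , p)
... | no ¬p = no λ { ([] , p) → ¬p p }
search (suc k) P? with search k (P? ∘ (false ∷_)) | search k (P? ∘ (true ∷_))
... | yes (c , p) | _           = yes (false ∷ c , p)
... | no _        | yes (c , p) = yes (true ∷ c , p)
... | no ¬f       | no ¬t       = no λ { (false ∷ c , p) → ¬f (c , p) ; (true ∷ c , p) → ¬t (c , p) }

-- Bit strings are the arguments of the fingerprint functions, so they are numbered by the 2 ^ n
-- columns of a table. In the last clause `pred n` is the length of v.
index : ∀ {n} → Vec Bool n → ℕ
index     []          = 0
index     (false ∷ v) = index v
index {n} (true  ∷ v) = 2 ^ (pred n) + index v

index<2^n : ∀ {n} (v : Vec Bool n) → index v < 2 ^ n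
index<2^n []                  = s≤s z≤n
index<2^n {suc n} (false ∷ v) = ≤-trans (index<2^n v) (m≤m+n _ _)
index<2^n {suc n} (true ∷ v)  = +-monoʳ-< (2 ^ n) (≤-trans (index<2^n v) (m≤m+n _ 0))

index-injective : ∀ {n} (u v : Vec Bool n) → index u ≡ index v → u ≡ v
index-injective []          []          _  = refl
index-injective (false ∷ u) (false ∷ v) eq = cong (false ∷_) (index-injective u v eq)
index-injective (true  ∷ u) (true  ∷ v) eq = cong (true ∷_) (index-injective u v (+-cancelˡ-≡ _ _ _ eq))
index-injective (false ∷ u) (true  ∷ v) eq = contradiction (≤-trans (m≤m+n _ _) (≤-reflexive (sym eq)))
    (<⇒≱ (index<2^n u))
index-injective (true  ∷ u) (false ∷ v) eq = contradiction (≤-trans (m≤m+n _ _) (≤-reflexive eq)) (<⇒≱ (index<2^n v))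

-- For n ≤ 2 ^ ν, blocks of length h = 2 ^ (ν ∸ i) give (4 h) ^ 2 ^ i as a bound
-- for the number of masks of weight at most 2 ^ i; this is its logarithm.
codeLength : ℕ → ℕ → ℕ
codeLength ν i = 2 ^ i * (ν ∸ i + 2)

module Code (n ν : ℕ) (n≤2^ν : n ≤ 2 ^ ν) where

  decodeMask : ∀ i → Vec Bool (codeLength ν i) → Vec Bool n
  decodeMask i = pick (Vec.replicate n false) _ (masks n (2 ^ i))

  decodeMask-surjective : ∀ i (v : Vec Bool n) → weight v ≤ 2 ^ i → ∃[ c ] decodeMask i c ≡ v
  decodeMask-surjective i v v≤ = pick-surjective _ _ _ few (∈-masks (2 ^ i) v v≤)
    where
    open ≤-Reasoning
    few : length (masks n (2 ^ i)) ≤ 2 ^ codeLength ν i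
    few = begin
      length (masks n (2 ^ i))    ≤⟨ length-masks≤ (2 ^ (ν ∸ i)) {{m^n≢0 2 (ν ∸ i)}} n (2 ^ i) (begin
        n                           ≤⟨ n≤2^ν ⟩
        2 ^ ν                       ≤⟨ ^-monoʳ-≤ 2 (m≤n+m∸n ν i) ⟩
        2 ^ (i + (ν ∸ i))           ≡⟨ cong (2 ^_) (+-comm i _) ⟩
        2 ^ (ν ∸ i + i)             ≡⟨ ^-distribˡ-+-* 2 (ν ∸ i) i ⟩
        2 ^ (ν ∸ i) * 2 ^ i         ∎) ⟩
      (4 * 2 ^ (ν ∸ i)) ^ (2 ^ i) ≡⟨ cong (_^ (2 ^ i))
          (trans (*-comm 4 (2 ^ (ν ∸ i))) (sym (^-distribˡ-+-* 2 (ν ∸ i) 2))) ⟩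
      (2 ^ (ν ∸ i + 2)) ^ (2 ^ i) ≡⟨ ^-*-assoc 2 (ν ∸ i + 2) (2 ^ i) ⟩
      2 ^ ((ν ∸ i + 2) * 2 ^ i)   ≡⟨ cong (2 ^_) (*-comm (ν ∸ i + 2) (2 ^ i)) ⟩
      2 ^ codeLength ν i          ∎

-- The protocol

_⊕_ _∪_ : ∀ {n} → Vec Bool n → Vec Bool n → Vec Bool n
_⊕_ = zipWith _xor_
_∪_ = zipWith _∨_

⊕-cancelˡ : ∀ {n} (u v : Vec Bool n) → u ⊕ (u ⊕ v) ≡ v
⊕-cancelˡ []          []      = refl
⊕-cancelˡ (false ∷ u) (b ∷ v) = cong (b ∷_) (⊕-cancelˡ u v)
⊕-cancelˡ (true  ∷ u) (false ∷ v) = cong (false ∷_) (⊕-cancelˡ u v)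
⊕-cancelˡ (true  ∷ u) (true ∷ v) = cong (true ∷_) (⊕-cancelˡ u v)

distinct : ∀ {n} → Vec ℕ n → Vec ℕ n → ℕ
distinct xs ys = weight (zipWith (λ x y → not (does (x ≟ⁿ y))) xs ys)

-- Positions in F are blanked in both strings. A plane then reports only new mismatches, which is
-- what allows the later planes to use ever smaller weights.
hashed : ∀ {n} → (ℕ → Bool) → Vec Bool n → Vec ℕ n → Vec Bool n
hashed h = zipWith λ f x → not f ∧ h x

-- Hashing is one-sided: equal letters have equal hashes for all coins. This is what makes a failed
-- plane a certificate for a large distance.
weight-hashed : ∀ {n} h (F : Vec Bool n) xs ys → weight (hashed h F ys ⊕ hashed h F xs) ≤ distinct xs ys
weight-hashed h []      []       []       = z≤n
weight-hashed h (f ∷ F) (x ∷ xs) (y ∷ ys) = +-mono-≤ (letter f (x ≟ⁿ y)) (weight-hashed h F xs ys)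
  where
  xor-same : ∀ b → b xor b ≡ false
  xor-same false = refl
  xor-same true  = refl
  letter : ∀ f (x≟y : Dec (x ≡ y)) → bit ((not f ∧ h y) xor (not f ∧ h x)) ≤ bit (not (does x≟y))
  letter f (no  _)    = bit≤1 _
  letter f (yes refl) = ≤-reflexive (cong bit (xor-same (not f ∧ h x)))

rows : Functions → ∀ k → ℕ → Vec Bool k
rows η zero    x = []
rows η (suc k) x = η k x ∷ rows η k x

rows-agree : ∀ η k {x y} → rows η k x ≡ rows η k y → agree η k x y ≡ true
rows-agree η zero    _  = refl
rows-agree η (suc k) {x} {y} eq = cong₂ _∧_ (same (cong head eq)) (rows-agree η k (cong tail eq))
  where
  same : ∀ {a b} → a ≡ b → (a ≡ᵇᵒ b) ≡ true
  same {false} refl = refl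
  same {true}  refl = refl

-- The default is never transmitted: `plane` asks for a code only after Bob has announced that one
-- exists.
choice : ∀ {k} {P : Vec Bool k → Set} → Dec (∃ P) → Vec Bool k
choice (yes (c , _)) = c
choice (no _)        = Vec.replicate _ false

-- The first summand of `hashLength` pays for the union bound over all codes, the second leaves an
-- error of 2 ^ (- σ 2 ^ i). The extra bit in `planeLength` is Bob's announcement.
hashLength planeLength : (ν σ i : ℕ) → ℕ
hashLength  ν σ i = codeLength ν i + σ * 2 ^ i
planeLength ν σ i = hashLength ν σ i + suc (codeLength ν i)

module Game (n ν : ℕ) (n≤2^ν : n ≤ 2 ^ ν) (T σ : ℕ)
            {X Y : Set} (α : X → Vec ℕ n) (β : Y → Vec ℕ n) where

  open Code n ν n≤2^ν

  Π : Set
  Π = Protocol X Y ℕ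

  aliceSendsVec : ∀ k → (X → Vec Bool k) → (Vec Bool k → Π) → Π
  aliceSendsVec zero    f π = π []
  aliceSendsVec (suc k) f π = aliceSends (head ∘ f) λ b → aliceSendsVec k (tail ∘ f) (π ∘ (b ∷_))

  bobSendsVec : ∀ k → (Y → Vec Bool k) → (Vec Bool k → Π) → Π
  bobSendsVec zero    f π = π []
  bobSendsVec (suc k) f π = bobSends (head ∘ f) λ b → bobSendsVec k (tail ∘ f) (π ∘ (b ∷_))

  codeBits hashBits planeBits : ℕ → ℕ
  codeBits  = codeLength ν
  hashBits  = hashLength ν σ
  planeBits = planeLength ν σ

  -- If T planes succeed at level j, they have detected at most T 2 ^ j ≤ 2 ^ (T + j) mismatches. If
  -- this is at least half of them, then the distance is at most 2 ^ `level j`.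
  level : ℕ → ℕ
  level j = suc (T + j)

  module Run (ρ η : Functions) where

    fingerprint : ∀ i → Vec Bool n → Vec Bool (hashBits i)
    fingerprint i z = rows η (hashBits i) (index z)

    Candidate : ∀ i (b : Vec Bool n) → Vec Bool (hashBits i) → Vec Bool (codeBits i) → Set
    Candidate i b v c = weight (decodeMask i c) ≤ 2 ^ i × fingerprint i (b ⊕ decodeMask i c) ≡ v

    find : ∀ i b v → Dec (∃ (Candidate i b v))
    find i b v = search _ λ c → (_ ≤? _) ×-dec (≡-dec _≟ᵇ_ _ _)

    plane : (i p : ℕ) → Vec Bool n → Π → (Vec Bool n → Π) → Π
    plane i p F fail succ =
      aliceSendsVec (hashBits i) (λ x → fingerprint i (hashed (ρ p) F (α x))) λ v →
      bobSends (λ y → does (find i (hashed (ρ p) F (β y)) v)) λ found →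
      if found
      then bobSendsVec (codeBits i) (λ y → choice (find i (hashed (ρ p) F (β y)) v)) (λ c → succ (F ∪ decodeMask i c))
      else fail

    planes : (t i p : ℕ) → Vec Bool n → Π → (Vec Bool n → Π) → Π
    planes zero    i p F fail succ = succ F
    planes (suc t) i p F fail succ = plane i p F fail λ F′ → planes t i (suc p) F′ fail succ

    -- Aborting, instead of raising the level again, keeps the cost of `finish` bounded for all
    -- coins.
    giveUp : Π
    giveUp = output (const 0) (const 0)

    -- The intended invariant is that at most 2 ^ r / 2 mismatches are undetected: they fit into
    -- level r - 1, and for r = 0 there are none.
    finish : (r p : ℕ) → Vec Bool n → Π
    finish zero    p F = output (const (weight F)) (const (weight F))
    finish (suc r) p F = planes T r p F giveUp (finish r (T + p))

    attempt : (r j : ℕ) → Π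
    next  : (r j : ℕ) → Π
    -- Every attempt starts again from plane 0 and the empty set. `1 * T` computes to `T + 0`, the
    -- plane index reached here, and is also `suc g * T` at g = 0, the form in which
    -- `finish-correct` counts stages.
    attempt r j = planes T j 0 (Vec.replicate n false) (next r j) (finish (level j) (1 * T))
    next zero    j = giveUp
    next (suc r) j = attempt r (suc j)

  -- One exchange for fixed inputs: a bits from Alice, then b bits from Bob, then π′. Recording the
  -- senders and not just their number lets the same fact yield both the rounds and the bits.
  record _,_⊢_⟶[_,_]_ (x : X) (y : Y) (π : Π) (a b : ℕ) (π′ : Π) : Set where
    field
      same-outputs : outputs π x y ≡ outputs π′ x y
      more-senders : senders π x y ≡ replicate a alice ++ replicate b bob ++ senders π′ x y

  open _,_⊢_⟶[_,_]_

  head∷tail : ∀ {k} (v : Vec Bool (suc k)) → head v ∷ tail v ≡ v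
  head∷tail (_ ∷ _) = refl

  alice-outputs : ∀ k f π x y → outputs (aliceSendsVec k f π) x y ≡ outputs (π (f x)) x y
  alice-outputs zero    f π x y with f x
  ... | [] = refl
  alice-outputs (suc k) f π x y =
    trans (alice-outputs k (tail ∘ f) _ x y) (cong (λ v → outputs (π v) x y) (head∷tail (f x)))

  alice-senders : ∀ k f π x y → senders (aliceSendsVec k f π) x y ≡ replicate k alice ++ senders (π (f x)) x y
  alice-senders zero    f π x y with f x
  ... | [] = refl
  alice-senders (suc k) f π x y = cong (alice ∷_)
    (trans (alice-senders k (tail ∘ f) _ x y) (cong (λ v → replicate k alice ++ senders (π v) x y) (head∷tail (f x))))

  bob-outputs : ∀ k f π x y → outputs (bobSendsVec k f π) x y ≡ outputs (π (f y)) x y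
  bob-outputs zero    f π x y with f y
  ... | [] = refl
  bob-outputs (suc k) f π x y =
    trans (bob-outputs k (tail ∘ f) _ x y) (cong (λ v → outputs (π v) x y) (head∷tail (f y)))

  bob-senders : ∀ k f π x y → senders (bobSendsVec k f π) x y ≡ replicate k bob ++ senders (π (f y)) x y
  bob-senders zero    f π x y with f y
  ... | [] = refl
  bob-senders (suc k) f π x y = cong (bob ∷_)
    (trans (bob-senders k (tail ∘ f) _ x y) (cong (λ v → replicate k bob ++ senders (π v) x y) (head∷tail (f y))))

  module Behaviour (ρ η : Functions) (x : X) (y : Y) where
    open Run ρ η

    word-A word-B : Vec ℕ n
    word-A = α x
    word-B = β y

    d : ℕ
    d = distinct word-A word-B

    difference : ℕ → Vec Bool n → Vec Bool n
    difference p F = hashed (ρ p) F word-B ⊕ hashed (ρ p) F word-A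

    -- The difference of the two strings turns Bob's string into Alice's, so it always passes the
    -- fingerprint test. If nothing is found, it can only have been too heavy, whatever the coins.
    plane-step : ∀ i p F fail succ →
      (x , y ⊢ plane i p F fail succ ⟶[ hashBits i , 1 ] fail × 2 ^ i < weight (difference p F)) ⊎
      (∃[ c ] Candidate i (hashed (ρ p) F word-B) (fingerprint i (hashed (ρ p) F word-A)) c
            × x , y ⊢ plane i p F fail succ ⟶[ hashBits i , suc (codeBits i) ] succ (F ∪ decodeMask i c))
    plane-step i p F fail succ = go (find i b v) refl
      where
      b = hashed (ρ p) F word-B
      v = fingerprint i (hashed (ρ p) F word-A)
      reply : Vec Bool (hashBits i) → Bool → Π
      reply v found = if found
        then bobSendsVec (codeBits i) (λ y → choice (find i (hashed (ρ p) F (β y)) v))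
            (λ c → succ (F ∪ decodeMask i c))
        else fail
      begins : outputs (plane i p F fail succ) x y ≡ outputs (reply v (does (find i b v))) x y
      begins = alice-outputs (hashBits i) _ _ x y
      begins′ : senders (plane i p F fail succ) x y ≡
                replicate (hashBits i) alice ++ bob ∷ senders (reply v (does (find i b v))) x y
      begins′ = alice-senders (hashBits i) _ _ x y
      -- The same search determines both Bob's announcement and his code; its result is generalised
      -- once and substituted in both places.
      go : (f : Dec (∃ (Candidate i b v))) → find i b v ≡ f →
        (x , y ⊢ plane i p F fail succ ⟶[ hashBits i , 1 ] fail × 2 ^ i < weight (difference p F)) ⊎
        (∃[ c ] Candidate i b v c × x , y ⊢ plane i p F fail succ ⟶[ hashBits i , suc (codeBits i) ] succ
            (F ∪ decodeMask i c))
      go (no ¬c) eq = inj₁ (record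
        { same-outputs = trans begins (cong (λ f → outputs (reply v (does f)) x y) eq)
        ; more-senders = trans begins′ (cong
            (λ f → replicate (hashBits i) alice ++ bob ∷ senders (reply v (does f)) x y) eq)
        } , ≰⇒> λ light → let c , c≡ = decodeMask-surjective i (difference p F) light in
              ¬c (c , subst (λ z → weight z ≤ 2 ^ i) (sym c≡) light
                    , cong (fingerprint i) (trans (cong (b ⊕_) c≡) (⊕-cancelˡ b _))))
      go (yes (c , cand)) eq = inj₂ (c , cand , record
        { same-outputs = trans begins (trans (cong (λ f → outputs (reply v (does f)) x y) eq)
            (trans (bob-outputs (codeBits i) _ _ x y)
                (cong (λ f → outputs (succ (F ∪ decodeMask i (choice f))) x y) eq)))
        ; more-senders = trans begins′ (cong (λ l → replicate (hashBits i) alice ++ bob ∷ l)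
            (trans (cong (λ f → senders (reply v (does f)) x y) eq)
            (trans (bob-senders (codeBits i) _ _ x y)
                   (cong (λ f → replicate (codeBits i) bob ++ senders (succ (F ∪ decodeMask i (choice f))) x y) eq))))
        })

    -- One analysis for both measures: for M the number of rounds a block costs 2, for M the number
    -- of bits it costs its length.
    module Cost (M : List Party → ℕ) (κ : ℕ → ℕ)
                (M-block : ∀ a b {q} l → a + b ≤ q → M (replicate a alice ++ replicate b bob ++ l) ≤ κ q + M l) where
      open ≤-Reasoning

      μ : Π → ℕ
      μ π = M (senders π x y)

      planeCost : ℕ → ℕ
      planeCost i = κ (planeBits i)

      step-cost : ∀ {π π′ a b} i → a + b ≤ planeBits i → x , y ⊢ π ⟶[ a , b ] π′ → μ π ≤ planeCost i + μ π′
      step-cost {π′ = π′} {a} {b} i le s =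
        ≤-trans (≤-reflexive (cong M (more-senders s))) (M-block a b (senders π′ x y) le)

      extend : ∀ i t {a b z} → b ≤ t * planeCost i + z → a ≤ planeCost i + b → a ≤ suc t * planeCost i + z
      extend i t {z = z} le le′ = ≤-trans le′
          (≤-trans (+-monoʳ-≤ (planeCost i) le) (≤-reflexive (sym (+-assoc (planeCost i) _ z))))

      planes-cost : ∀ t i p F fail succ →
        (2 ^ i < d × μ (planes t i p F fail succ) ≤ t * planeCost i + μ fail) ⊎
        (∃[ F′ ] μ (planes t i p F fail succ) ≤ t * planeCost i + μ (succ F′))
      planes-cost zero    i p F fail succ = inj₂ (F , ≤-refl)
      planes-cost (suc t) i p F fail succ with plane-step i p F fail (λ F′ → planes t i (suc p) F′ fail succ)
      ... | inj₁ (s , heavy) = inj₁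
        ( <-≤-trans heavy (weight-hashed (ρ p) F word-A word-B)
        , ≤-trans (step-cost i (+-monoʳ-≤ (hashBits i) (s≤s z≤n)) s) (+-monoˡ-≤ (μ fail) (m≤m+n _ _)))
      ... | inj₂ (c , _ , s) with planes-cost t i (suc p) (F ∪ decodeMask i c) fail succ
      ...   | inj₁ (i<d , le) = inj₁ (i<d , extend i t le (step-cost i ≤-refl s))
      ...   | inj₂ (F′ , le) = inj₂ (F′ , extend i t le (step-cost i ≤-refl s))

      regroup : ∀ t a b c → t * a + (t * b + c) ≡ t * (a + b) + c
      regroup = solve-∀

      regroup′ : ∀ t a b c → t * a + (t * b + c) ≡ t * (b + a) + c
      regroup′ = solve-∀

      levels : ℕ → ℕ
      levels r = ∑< r planeCost

      finish-cost : ∀ r p F → μ (finish r p F) ≤ T * levels r + M []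
      finish-cost zero    p F = m≤n+m _ _
      finish-cost (suc r) p F with planes-cost T r p F giveUp (finish r (T + p))
      ... | inj₁ (_ , le) = ≤-trans le (+-monoˡ-≤ (M []) (*-monoʳ-≤ T (m≤m+n _ _)))
      ... | inj₂ (F′ , le) = begin
        μ (finish (suc r) p F)                       ≤⟨ le ⟩
        T * planeCost r + μ (finish r (T + p) F′)     ≤⟨ +-monoʳ-≤ _ (finish-cost r (T + p) F′) ⟩
        T * planeCost r + (T * levels r + M [])       ≡⟨ regroup T (planeCost r) (levels r) _ ⟩
        T * levels (suc r) + M []                    ∎

      -- A failed level j certifies 2 ^ j < d, for all coins.
      attempt-cost : ∀ D → d ≤ D → ∀ r j → 2 ^ j ≤ 2 * D → ∃[ k ] 2 ^ k ≤ 2 * D ×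
        T * levels j + μ (attempt r j) ≤ T * levels (suc k) + (T * levels (level k) + M [])
      attempt-cost D d≤D r j small with planes-cost T j 0 (Vec.replicate n false) (next r j)
          (finish (level j) (1 * T))
      ... | inj₂ (F′ , le) = j , small , (begin
        T * levels j + μ (attempt r j)
          ≤⟨ +-monoʳ-≤ (T * levels j) (≤-trans le (+-monoʳ-≤ _ (finish-cost (level j) (1 * T) F′))) ⟩
        T * levels j + (T * planeCost j + (T * levels (level j) + M []))
          ≡⟨ regroup′ T (levels j) (planeCost j) _ ⟩
        T * levels (suc j) + (T * levels (level j) + M []) ∎)
      attempt-cost D d≤D zero j small | inj₁ (_ , le) = j , small , (begin
        T * levels j + μ (attempt zero j)              ≤⟨ +-monoʳ-≤ (T * levels j) le ⟩
        T * levels j + (T * planeCost j + M [])       ≡⟨ regroup′ T (levels j) (planeCost j) _ ⟩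
        T * levels (suc j) + M []                    ≤⟨ +-monoʳ-≤ (T * levels (suc j))
            (m≤n+m (M []) (T * levels (level j))) ⟩
        T * levels (suc j) + (T * levels (level j) + M []) ∎)
      attempt-cost D d≤D (suc r) j small | inj₁ (j<d , le)
        with attempt-cost D d≤D r (suc j) (*-monoʳ-≤ 2 (≤-trans (<⇒≤ j<d) d≤D))
      -- The cost of the failed level j joins what has been spent before. This is why the claim
      -- carries `T * levels j` on the left.
      ... | k , k-small , le′ = k , k-small , (begin
        T * levels j + μ (attempt (suc r) j)                    ≤⟨ +-monoʳ-≤ (T * levels j) le ⟩
        T * levels j + (T * planeCost j + μ (attempt r (suc j))) ≡⟨ regroup′ T (levels j) (planeCost j) _ ⟩
        T * levels (suc j) + μ (attempt r (suc j))              ≤⟨ le′ ⟩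
        T * levels (suc k) + (T * levels (level k) + M [])    ∎)

-- Detected and undetected mismatches

-- The set that an execution without false positives has collected after p planes. It depends on the
-- letter hashes only, not on the fingerprints or on the levels tried.
detected : ∀ {n} → Functions → ℕ → Vec ℕ n → Vec ℕ n → Vec Bool n
detected ρ p = zipWith λ x y → not (agree ρ p x y)

undetected : ∀ {n} → Functions → ℕ → Vec ℕ n → Vec ℕ n → ℕ
undetected ρ p xs ys = weight (zipWith (λ x y → not (does (x ≟ⁿ y)) ∧ agree ρ p x y) xs ys)

detected-zero : ∀ {n} ρ (xs ys : Vec ℕ n) → detected ρ 0 xs ys ≡ Vec.replicate n false
detected-zero ρ []       []       = refl
detected-zero ρ (x ∷ xs) (y ∷ ys) = cong (false ∷_) (detected-zero ρ xs ys)

weight-replicate : ∀ n → weight (Vec.replicate n false) ≡ 0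
weight-replicate zero    = refl
weight-replicate (suc n) = weight-replicate n

shuffle : ∀ a b {s t u} → s + t ≡ u → (a + s) + (b + t) ≡ (a + b) + u
shuffle a b {s} {t} eq = trans (lemma a b s t) (cong (a + b +_) eq)
  where
  lemma : ∀ a b s t → (a + s) + (b + t) ≡ (a + b) + (s + t)
  lemma = solve-∀

detected+undetected : ∀ {n} ρ p (xs ys : Vec ℕ n) →
                      weight (detected ρ p xs ys) + undetected ρ p xs ys ≡ distinct xs ys
detected+undetected ρ p []       []       = refl
detected+undetected ρ p (x ∷ xs) (y ∷ ys) =
  trans (shuffle (bit (not (agree ρ p x y))) (bit (not (does (x ≟ⁿ y)) ∧ agree ρ p x y))
      (detected+undetected ρ p xs ys))
        (cong (_+ distinct xs ys) (letter (x ≟ⁿ y)))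
  where
  letter : (x≟y : Dec (x ≡ y)) → bit (not (agree ρ p x y)) + bit (not (does x≟y) ∧ agree ρ p x y) ≡ bit
      (not (does x≟y))
  letter (yes refl) rewrite agree-refl ρ p x = refl
  letter (no _) with agree ρ p x y
  ... | true  = refl
  ... | false = refl

undetected-step : ∀ {n} ρ p (xs ys : Vec ℕ n) → undetected ρ (suc p) xs ys ≤ undetected ρ p xs ys
undetected-step ρ p []       []       = z≤n
undetected-step ρ p (x ∷ xs) (y ∷ ys) =
  +-mono-≤ (letter (not (does (x ≟ⁿ y))) (ρ p x ≡ᵇᵒ ρ p y) (agree ρ p x y)) (undetected-step ρ p xs ys)
  where
  letter : ∀ a b c → bit (a ∧ (b ∧ c)) ≤ bit (a ∧ c)
  letter false _     _ = z≤n
  letter true  false _ = z≤n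
  letter true  true  _ = ≤-refl

module _ (ρ : Functions) (p : ℕ) where

  newlyDetected : ∀ {n} → Vec ℕ n → Vec ℕ n → Vec Bool n
  newlyDetected xs ys = hashed (ρ p) (detected ρ p xs ys) ys ⊕ hashed (ρ p) (detected ρ p xs ys) xs

  detected-∪ : ∀ {n} (xs ys : Vec ℕ n) → detected ρ p xs ys ∪ newlyDetected xs ys ≡ detected ρ (suc p) xs ys
  detected-∪ []       []       = refl
  detected-∪ (x ∷ xs) (y ∷ ys) = cong₂ _∷_ (letter (agree ρ p x y) (ρ p x) (ρ p y)) (detected-∪ xs ys)
    where
    letter : ∀ g a b → not g ∨ ((not (not g) ∧ b) xor (not (not g) ∧ a)) ≡ not ((a ≡ᵇᵒ b) ∧ g)
    letter true  true  true  = refl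
    letter true  true  false = refl
    letter true  false true  = refl
    letter true  false false = refl
    letter false true  true  = refl
    letter false true  false = refl
    letter false false true  = refl
    letter false false false = refl

  -- The weights add up because `hashed` blanks the detected positions, so that old and new ones are
  -- disjoint.
  weight-newlyDetected : ∀ {n} (xs ys : Vec ℕ n) →
    weight (newlyDetected xs ys) + weight (detected ρ p xs ys) ≡ weight (detected ρ (suc p) xs ys)
  weight-newlyDetected []       []       = refl
  weight-newlyDetected (x ∷ xs) (y ∷ ys) =
    trans (shuffle (bit ((not (not g) ∧ ρ p y) xor (not (not g) ∧ ρ p x))) (bit (not g)) (weight-newlyDetected xs ys))
          (cong (_+ weight (detected ρ (suc p) xs ys)) (letter g (ρ p x) (ρ p y)))
    where
    g = agree ρ p x y
    letter : ∀ g a b → bit ((not (not g) ∧ b) xor (not (not g) ∧ a)) + bit (not g) ≡ bit (not ((a ≡ᵇᵒ b) ∧ g))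
    letter true  true  true  = refl
    letter true  true  false = refl
    letter true  false true  = refl
    letter true  false false = refl
    letter false true  true  = refl
    letter false true  false = refl
    letter false false true  = refl
    letter false false false = refl

  newlyDetected≤undetected : ∀ {n} (xs ys : Vec ℕ n) → weight (newlyDetected xs ys) ≤ undetected ρ p xs ys
  newlyDetected≤undetected xs ys = +-cancelʳ-≤ (weight (detected ρ p xs ys)) _ _ (begin
    weight (newlyDetected xs ys) + weight (detected ρ p xs ys) ≡⟨ weight-newlyDetected xs ys ⟩
    weight (detected ρ (suc p) xs ys)                          ≤⟨ m≤m+n _ _ ⟩
    weight (detected ρ (suc p) xs ys) + undetected ρ (suc p) xs ys ≡⟨ detected+undetected ρ (suc p) xs ys ⟩
    distinct xs ys                                             ≡⟨ detected+undetected ρ p xs ys ⟨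
    weight (detected ρ p xs ys) + undetected ρ p xs ys         ≡⟨ +-comm (weight (detected ρ p xs ys)) _ ⟩
    undetected ρ p xs ys + weight (detected ρ p xs ys)         ∎)
    where open ≤-Reasoning

_≟ⱽ_ : ∀ {n} (u v : Vec Bool n) → Dec (u ≡ v)
_≟ⱽ_ = ≡-dec _≟ᵇ_

-- The ideal execution for fixed letter hashes

module Correctness (n ν : ℕ) (n≤2^ν : n ≤ 2 ^ ν) (T σ : ℕ)
                   {X Y : Set} (α : X → Vec ℕ n) (β : Y → Vec ℕ n)
                   (ρ : Functions) (x : X) (y : Y) where

  open Game n ν n≤2^ν T σ α β
  open Code n ν n≤2^ν
  open _,_⊢_⟶[_,_]_

  word-A word-B : Vec ℕ n
  word-A = α x
  word-B = β y

  d : ℕ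
  d = distinct word-A word-B

  F : ℕ → Vec Bool n
  F p = detected ρ p word-A word-B

  u : ℕ → ℕ
  u p = undetected ρ p word-A word-B

  δ : ℕ → Vec Bool n
  δ p = newlyDetected ρ p word-A word-B

  string-A string-B : ℕ → Vec Bool n
  string-A p = hashed (ρ p) (F p) word-A
  string-B p = hashed (ρ p) (F p) word-B

  -- Both strings come from the ideal execution and hence do not depend on η, so the event is a
  -- collision of two fixed arguments.
  falsePositive : ∀ i p → Functions → Vec Bool (codeBits i) → Bool
  falsePositive i p η c =
    not (does (z ≟ⱽ string-A p)) ∧ agree η (hashBits i) (index z) (index (string-A p))
    where z = string-B p ⊕ decodeMask i c

  planeErrors : ℕ → ℕ → Functions → ℕ
  planeErrors i p η = ∑ (overBits (codeBits i)) λ c → bit (falsePositive i p η c)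

  -- Simulation up to errors. Errors are counted rather than merely noted, so that composition adds
  -- them and the expected count is the union bound.
  record _↝[_]_ (π : Functions → Π) (err : Functions → ℕ) (π′ : Functions → Π) : Set where
    constructor act
    field
      acts : ∀ η → 1 ≤ err η ⊎ outputs (π η) x y ≡ outputs (π′ η) x y

  open _↝[_]_

  ↝-mono : ∀ {π π′ e e′} → (∀ η → e η ≤ e′ η) → π ↝[ e ] π′ → π ↝[ e′ ] π′
  ↝-mono {e = e} {e′} e≤e′ s .acts η with acts s η
  ... | inj₁ err = inj₁ (≤-trans err (e≤e′ η))
  ... | inj₂ eq  = inj₂ eq

  ↝-trans : ∀ {π π′ π″ e e′} → π ↝[ e ] π′ → π′ ↝[ e′ ] π″ → π ↝[ (λ η → e η + e′ η) ] π″
  ↝-trans s s′ .acts η with acts s η | acts s′ η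
  ... | inj₁ err | _        = inj₁ (≤-trans err (m≤m+n _ _))
  ... | inj₂ _   | inj₁ err = inj₁ (≤-trans err (m≤n+m _ _))
  ... | inj₂ eq  | inj₂ eq′ = inj₂ (trans eq eq′)

  module _ (i p : ℕ) where

    -- A mask that takes Bob's string to Alice's must be the true difference, by cancellation; any
    -- other candidate is itself a false positive.
    found-or-error : ∀ η c → Run.Candidate ρ η i (string-B p) (Run.fingerprint ρ η i (string-A p)) c →
                     1 ≤ planeErrors i p η ⊎ decodeMask i c ≡ δ p
    found-or-error η c (_ , same) with (string-B p ⊕ decodeMask i c) ≟ⱽ string-A p in eq
    ... | yes z≡ = inj₂ (trans (sym (⊕-cancelˡ (string-B p) (decodeMask i c))) (cong (string-B p ⊕_) z≡))
    ... | no  _  = inj₁ (≤-trans (≤-reflexive (sym error))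
        (∑-term (overBits (codeBits i)) (bit ∘ falsePositive i p η) c))
      where
      error : bit (falsePositive i p η c) ≡ 1
      error rewrite eq | rows-agree η (hashBits i) same = refl

    module _ (fail : Functions → Π) (succ : Functions → Vec Bool n → Π) where

      planeRun : Functions → Π
      planeRun η = Run.plane ρ η i p (F p) (fail η) (succ η)

      plane-passes : weight (δ p) ≤ 2 ^ i → planeRun ↝[ planeErrors i p ] λ η → succ η (F (suc p))
      plane-passes light .acts η with Behaviour.plane-step ρ η x y i p (F p) (fail η) (succ η)
      ... | inj₁ (_ , heavy) = contradiction light (<⇒≱ heavy)
      ... | inj₂ (c , cand , s) with found-or-error η c cand
      ...   | inj₁ err = inj₁ err
      ...   | inj₂ c≡  = inj₂ (trans (same-outputs s) (cong (λ G → outputs (succ η G) x y)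
                           (trans (cong (F p ∪_) c≡) (detected-∪ ρ p word-A word-B))))

      plane-fails : 2 ^ i < weight (δ p) → planeRun ↝[ planeErrors i p ] fail
      plane-fails heavy .acts η with Behaviour.plane-step ρ η x y i p (F p) (fail η) (succ η)
      ... | inj₁ (s , _) = inj₂ (same-outputs s)
      ... | inj₂ (c , cand , s) with found-or-error η c cand
      ...   | inj₁ err = inj₁ err
      ...   | inj₂ c≡  = contradiction (subst (λ v → weight v ≤ 2 ^ i) c≡ (proj₁ cand)) (<⇒≱ heavy)

  planesErrors : ℕ → ℕ → ℕ → Functions → ℕ
  planesErrors zero    i p η = 0
  planesErrors (suc t) i p η = planeErrors i p η + planesErrors t i (suc p) η

  planesFrom : ℕ → ℕ → ℕ → (Functions → Π) → (Functions → Vec Bool n → Π) → Functions → Vec Bool n → Π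
  planesFrom t i p fail succ η G = Run.planes ρ η t i p G (fail η) (succ η)

  planesRun : ℕ → ℕ → ℕ → (Functions → Π) → (Functions → Vec Bool n → Π) → Functions → Π
  planesRun t i p fail succ η = planesFrom t i p fail succ η (F p)

  -- The letter hashes alone decide the alternative: either all t planes are light, or the first
  -- heavy one stops the run. The weight bound, at most 2 ^ i new positions per light plane, later
  -- turns success into an upper bound for d.
  planes-correct : ∀ t i p fail succ →
    (planesRun t i p fail succ ↝[ planesErrors t i p ] (λ η → succ η (F (t + p)))
      × weight (F (t + p)) ≤ t * 2 ^ i + weight (F p)) ⊎
    (planesRun t i p fail succ ↝[ planesErrors t i p ] fail × 2 ^ i < u p)
  planes-correct zero    i p fail succ = inj₁ (act (λ η → inj₂ refl) , ≤-refl)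
  planes-correct (suc t) i p fail succ with weight (δ p) ≤? 2 ^ i
  ... | no heavy = inj₂ (↝-mono (λ η → m≤m+n _ _)
      (plane-fails i p fail (planesFrom t i (suc p) fail succ) (≰⇒> heavy))
                        , <-≤-trans (≰⇒> heavy) (newlyDetected≤undetected ρ p word-A word-B))
  ... | yes light with planes-correct t i (suc p) fail succ
  ...   | inj₂ (s , i<u) = inj₂ (↝-trans
      (plane-passes i p fail (planesFrom t i (suc p) fail succ) light) s , <-≤-trans i<u
      (undetected-step ρ p word-A word-B))
  ...   | inj₁ (s , few) rewrite +-suc t p = inj₁
      (↝-trans (plane-passes i p fail (planesFrom t i (suc p) fail succ) light) s , (begin
    weight (F (suc (t + p)))                        ≤⟨ few ⟩
    t * 2 ^ i + weight (F (suc p))                  ≡⟨ cong (t * 2 ^ i +_) (weight-newlyDetected ρ p word-A word-B) ⟨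
    t * 2 ^ i + (weight (δ p) + weight (F p))       ≤⟨ +-monoʳ-≤ (t * 2 ^ i) (+-monoˡ-≤ _ light) ⟩
    t * 2 ^ i + (2 ^ i + weight (F p))              ≡⟨ rearrange (t * 2 ^ i) (2 ^ i) _ ⟩
    2 ^ i + t * 2 ^ i + weight (F p)                ∎))
    where
    open ≤-Reasoning
    rearrange : ∀ a b c → a + (b + c) ≡ b + a + c
    rearrange = solve-∀

  -- The event for the letter hashes: g stages of T planes leave at most d / 2 ^ g mismatches. The
  -- range of g covers the doubling stage and all stages of the longest possible `finish`.
  Good : Set
  Good = ∀ g → g ≤ suc (level ν) → 2 ^ g * u (g * T) ≤ d

  finishErrors : ℕ → ℕ → Functions → ℕ
  finishErrors zero    p η = 0
  finishErrors (suc r) p η = planesErrors T r p η + finishErrors r (T + p) η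

  answer : Functions → Π
  answer η = output (const d) (const d)

  -- Levels after the successful one are counted as well, so the estimate does not depend on where
  -- the doubling stops.
  attemptErrors : ℕ → ℕ → Functions → ℕ
  attemptErrors zero    j η = planesErrors T j 0 η + 0
  attemptErrors (suc r) j η = planesErrors T j 0 η + attemptErrors r (suc j) η

  run : ℕ → ℕ → Functions → Π
  run r j η = Run.attempt ρ η r j

  from-start : ∀ r j {e π′} →
    planesRun T j 0 (λ η → Run.next ρ η r j) (λ η → Run.finish ρ η (level j) (1 * T)) ↝[ e ] π′ → run r j ↝[ e ] π′
  from-start r j {e} {π′} = subst
    (λ G → (λ η → Run.planes ρ η T j 0 G (Run.next ρ η r j) (Run.finish ρ η (level j) (1 * T))) ↝[ e ] π′)
    (detected-zero ρ word-A word-B)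

  module _ (good : Good) where
    open ≤-Reasoning

    -- `Good` leaves at most d / 2 ^ (g + 1) ≤ 2 ^ r / 2 mismatches after `suc g` stages. For
    -- positive r they fit into the next level, so no plane overflows; for r = 0 fewer than one is
    -- left, and the collected set is complete.
    finish-correct : ∀ r g → g + r ≤ level ν → d ≤ 2 ^ (g + r) →
                     (λ η → Run.finish ρ η r (suc g * T) (F (suc g * T))) ↝[ finishErrors r (suc g * T) ] answer
    finish-correct zero g ≤level d≤ .acts η = inj₂ (cong (λ k → k , k) (begin-equality
      weight (F (suc g * T))                        ≡⟨ +-identityʳ _ ⟨
      weight (F (suc g * T)) + 0                    ≡⟨ cong (weight (F (suc g * T)) +_) none ⟨
      weight (F (suc g * T)) + u (suc g * T)        ≡⟨ detected+undetected ρ (suc g * T) word-A word-B ⟩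
      d                                             ∎))
      where
      none : u (suc g * T) ≡ 0
      none = n<1⇒n≡0 (*-cancelˡ-< (2 ^ suc g) _ 1 (begin-strict
        2 ^ suc g * u (suc g * T) ≤⟨ good (suc g) (s≤s (subst (_≤ level ν) (+-identityʳ g) ≤level)) ⟩
        d                         ≤⟨ subst (λ k → d ≤ 2 ^ k) (+-identityʳ g) d≤ ⟩
        2 ^ g                     <⟨ ^-monoʳ-< 2 (s≤s (s≤s z≤n)) (n<1+n g) ⟩
        2 ^ suc g                 ≡⟨ *-identityʳ _ ⟨
        2 ^ suc g * 1             ∎))
    finish-correct (suc r) g ≤level d≤ with planes-correct T r (suc g * T)
      (λ η → Run.giveUp ρ η) (λ η → Run.finish ρ η r (suc (suc g) * T))
    ... | inj₁ (s , _)   = ↝-trans s (finish-correct r (suc g) (subst (_≤ level ν) (+-suc g r) ≤level)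
                                       (subst (λ k → d ≤ 2 ^ k) (+-suc g r) d≤))
    ... | inj₂ (_ , r<u) = contradiction (*-cancelˡ-≤ (2 ^ suc g) {{m^n≢0 2 (suc g)}} (begin
        2 ^ suc g * u (suc g * T) ≤⟨ good (suc g) (s≤s (≤-trans (m≤m+n g _) ≤level)) ⟩
        d                         ≤⟨ subst (λ k → d ≤ 2 ^ k) (+-suc g r) d≤ ⟩
        2 ^ (suc g + r)           ≡⟨ ^-distribˡ-+-* 2 (suc g) r ⟩
        2 ^ suc g * 2 ^ r         ∎)) (<⇒≱ r<u)

    -- By `Good` at g = 1 the first stage detects at least half of the mismatches, and its success
    -- limits their number to T 2 ^ j.
    d≤2^level : ∀ j → weight (F (1 * T)) ≤ T * 2 ^ j + weight (F 0) → d ≤ 2 ^ level j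
    d≤2^level j few = begin
      d                                 ≡⟨ split-d ⟨
      weight (F (1 * T)) + u (1 * T)    ≤⟨ +-mono-≤ found (≤-trans u≤found found) ⟩
      2 ^ (T + j) + 2 ^ (T + j)         ≡⟨ cong (2 ^ (T + j) +_) (+-identityʳ _) ⟨
      2 ^ level j                       ∎
      where
      split-d = detected+undetected ρ (1 * T) word-A word-B
      found : weight (F (1 * T)) ≤ 2 ^ (T + j)
      found = begin
        weight (F (1 * T))         ≤⟨ few ⟩
        T * 2 ^ j + weight (F 0)   ≡⟨ cong (T * 2 ^ j +_)
            (trans (cong weight (detected-zero ρ word-A word-B)) (weight-replicate n)) ⟩
        T * 2 ^ j + 0              ≡⟨ +-identityʳ _ ⟩
        T * 2 ^ j                  ≤⟨ *-monoˡ-≤ (2 ^ j) (m≤2^m T) ⟩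
        2 ^ T * 2 ^ j              ≡⟨ ^-distribˡ-+-* 2 T j ⟨
        2 ^ (T + j)                ∎
      u≤found : u (1 * T) ≤ weight (F (1 * T))
      u≤found = +-cancelʳ-≤ (u (1 * T)) _ _ (begin
        u (1 * T) + u (1 * T)           ≡⟨ cong (u (1 * T) +_) (+-identityʳ _) ⟨
        2 ^ 1 * u (1 * T)               ≤⟨ good 1 (s≤s z≤n) ⟩
        d                               ≡⟨ split-d ⟨
        weight (F (1 * T)) + u (1 * T)  ∎)

    attempt-correct : ∀ r j → j + r ≡ ν →
      ∃[ k ] k ≤ ν × run r j ↝[ (λ η → attemptErrors r j η + finishErrors (level k) (1 * T) η) ] answer
    attempt-correct r j j+r≡ν with planes-correct T j 0
      (λ η → Run.next ρ η r j) (λ η → Run.finish ρ η (level j) (1 * T))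
    ... | inj₁ (s , few) = j , j≤ν , ↝-mono (λ η → +-monoˡ-≤ _ (first r η))
            (↝-trans (from-start r j s) (finish-correct (level j) 0 (s≤s (+-monoʳ-≤ T j≤ν)) (d≤2^level j few)))
      where
      j≤ν = ≤-trans (m≤m+n j r) (≤-reflexive j+r≡ν)
      first : ∀ r η → planesErrors T j 0 η ≤ attemptErrors r j η
      first zero    η = m≤m+n _ _
      first (suc r) η = m≤m+n _ _
    -- The last level cannot overflow: its weight bound 2 ^ ν is at least n.
    attempt-correct zero j j+0≡ν | inj₂ (s , j<u) = contradiction (begin
      u 0                      ≤⟨ m≤n+m _ _ ⟩
      weight (F 0) + u 0       ≡⟨ detected+undetected ρ 0 word-A word-B ⟩
      d                        ≤⟨ weight≤n (zipWith (λ x y → not (does (x ≟ⁿ y))) word-A word-B) ⟩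
      n                        ≤⟨ n≤2^ν ⟩
      2 ^ ν                    ≡⟨ cong (2 ^_) (trans (sym j+0≡ν) (+-identityʳ j)) ⟩
      2 ^ j                    ∎) (<⇒≱ j<u)
    attempt-correct (suc r) j j+r≡ν | inj₂ (s , _) with attempt-correct r (suc j) (trans (sym (+-suc j r)) j+r≡ν)
    ... | k , k≤ν , s′ = k , k≤ν , ↝-mono (λ η → ≤-reflexive (sym (+-assoc (planesErrors T j 0 η) _ _)))
        (↝-trans (from-start (suc r) j s) s′)

∑-zero : ∀ {A} (S : Summation A) → ∑ S (const 0) ≡ 0
∑-zero S = ∑-const S 0

both? : ∀ v (o : ℕ × ℕ) → Dec (proj₁ o ≡ v × proj₂ o ≡ v)
both? v o = (proj₁ o ≟ⁿ v) ×-dec (proj₂ o ≟ⁿ v)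

wrong : ℕ → ℕ × ℕ → ℕ
wrong v o = bit (not (does (both? v o)))

wrong-correct : ∀ v → wrong v (v , v) ≡ 0
wrong-correct v = cong (bit ∘ not) (dec-true (both? v (v , v)) (refl , refl))

-- Error probabilities

module HashErrors (n ν : ℕ) (n≤2^ν : n ≤ 2 ^ ν) (T σ : ℕ) (1≤σ : 1 ≤ σ)
                  {X Y : Set} (α : X → Vec ℕ n) (β : Y → Vec ℕ n)
                  (ρ : Functions) (x : X) (y : Y)
                  (hashRows : ℕ) (enough : ∀ i → i ≤ suc (T + ν) → hashLength ν σ i ≤ hashRows) where

  open Correctness n ν n≤2^ν T σ α β ρ x y
  open Game n ν n≤2^ν T σ α β using (hashBits; codeBits; level)
  open Code n ν n≤2^ν
  open ≤-Reasoning

  H : Summation (Table hashRows (2 ^ n))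
  H = overTables hashRows (2 ^ n)

  expected : (Functions → ℕ) → ℕ
  expected f = ∑ H (f ∘ functions)

  -- Union bound: each of the 2 ^ `codeBits i` masks collides with probability at most 2 ^ (-
  -- `hashBits i`), and the exponents differ by `σ * 2 ^ i`.
  planeErrors-rare : ∀ i p → i ≤ level ν → expected (planeErrors i p) * 2 ^ (σ * 2 ^ i) ≤ card H
  planeErrors-rare i p i≤ = *-cancelʳ-≤ _ _ (2 ^ codeBits i) {{m^n≢0 2 (codeBits i)}} (begin
    expected (planeErrors i p) * 2 ^ (σ * 2 ^ i) * 2 ^ codeBits i
      ≡⟨ *-assoc (expected (planeErrors i p)) _ _ ⟩
    expected (planeErrors i p) * (2 ^ (σ * 2 ^ i) * 2 ^ codeBits i)
      ≡⟨ cong (expected (planeErrors i p) *_)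
          (trans (*-comm (2 ^ (σ * 2 ^ i)) _) (sym (^-distribˡ-+-* 2 (codeBits i) _))) ⟩
    expected (planeErrors i p) * 2 ^ hashBits i
      ≡⟨ cong (_* 2 ^ hashBits i) (∑-swap H (codeBits i) λ t c → bit (falsePositive i p (functions t) c)) ⟩
    ∑ codes (λ c → ∑ H λ t → bit (falsePositive i p (functions t) c)) * 2 ^ hashBits i
      ≡⟨ ∑-*ʳ codes _ (2 ^ hashBits i) ⟨
    ∑ codes (λ c → ∑ H (λ t → bit (falsePositive i p (functions t) c)) * 2 ^ hashBits i)
      ≤⟨ ∑-mono codes each ⟩
    ∑ codes (const (card H))
      ≡⟨ trans (∑-const codes (card H)) (cong (card H *_) (card-overBits (codeBits i))) ⟩
    card H * 2 ^ codeBits i ∎)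
    where
    codes = overBits (codeBits i)
    each : ∀ c → ∑ H (λ t → bit (falsePositive i p (functions t) c)) * 2 ^ hashBits i ≤ card H
    each c with (string-B p ⊕ decodeMask i c) ≟ⱽ string-A p
    ... | yes _  = ≤-trans (≤-reflexive (cong (_* 2 ^ hashBits i) (∑-zero H))) z≤n
    ... | no z≢a = ≤-reflexive (collision (hashBits i) (enough i i≤) (index<2^n (string-B p ⊕ decodeMask i c))
        (index<2^n (string-A p))
                     (z≢a ∘ index-injective (string-B p ⊕ decodeMask i c) (string-A p)))

  -- The exponent `σ * 2 ^ i` is weakened to `σ + i`, possible as 1 ≤ σ; this is just what the
  -- geometric sums over the levels need.
  planesErrors-rare : ∀ t i p → i ≤ level ν → expected (planesErrors t i p) * 2 ^ (σ + i) ≤ t * card H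
  planesErrors-rare zero    i p i≤ = ≤-reflexive (cong (_* 2 ^ (σ + i)) (∑-zero H))
  planesErrors-rare (suc t) i p i≤ = begin
    expected (planesErrors (suc t) i p) * 2 ^ (σ + i)
      ≡⟨ cong (_* 2 ^ (σ + i)) (∑-+ H _ _) ⟩
    (expected (planeErrors i p) + expected (planesErrors t i (suc p))) * 2 ^ (σ + i)
      ≡⟨ *-distribʳ-+ (2 ^ (σ + i)) (expected (planeErrors i p)) _ ⟩
    expected (planeErrors i p) * 2 ^ (σ + i) + expected (planesErrors t i (suc p)) * 2 ^ (σ + i)
      ≤⟨ +-mono-≤ (≤-trans (*-monoʳ-≤ (expected (planeErrors i p)) (^-monoʳ-≤ 2 σ+i≤)) (planeErrors-rare i p i≤))
                  (planesErrors-rare t i (suc p) i≤) ⟩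
    suc t * card H ∎
    where
    σ+i≤ : σ + i ≤ σ * 2 ^ i
    σ+i≤ = begin
      σ + i       ≡⟨ cong (σ +_) (*-identityˡ i) ⟨
      σ + 1 * i   ≤⟨ +-monoʳ-≤ σ (*-monoˡ-≤ i 1≤σ) ⟩
      σ + σ * i   ≡⟨ *-suc σ i ⟨
      σ * suc i   ≤⟨ *-monoʳ-≤ σ (1+m≤2^m i) ⟩
      σ * 2 ^ i   ∎

  finishErrors-rare : ∀ r p → r ≤ suc (level ν) → expected (finishErrors r p) * 2 ^ σ ≤ 2 * (T * card H)
  finishErrors-rare r p r≤ = geometric-start r (expected (finishErrors r p) * 2 ^ σ) _ (go r p r≤)
    where
    go : ∀ r p → r ≤ suc (level ν) →
         expected (finishErrors r p) * 2 ^ σ * 2 ^ r + 2 * (T * card H) ≤ 2 ^ r * (2 * (T * card H))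
    go zero    p _        = ≤-reflexive (trans
      (cong (λ k → k * 2 ^ σ * 1 + 2 * (T * card H)) (∑-zero H))
      (sym (*-identityˡ (2 * (T * card H)))))
    go (suc r) p (s≤s r≤) = subst (λ k → k * 2 ^ suc r + 2 * (T * card H) ≤ 2 ^ suc r * (2 * (T * card H)))
      (trans (sym (*-distribʳ-+ (2 ^ σ) (expected (planesErrors T r p)) _)) (cong (_* 2 ^ σ) (sym (∑-+ H _ _))))
      (geometric-step r (expected (finishErrors r (T + p)) * 2 ^ σ) (expected (planesErrors T r p) * 2 ^ σ) _ (begin
        expected (planesErrors T r p) * 2 ^ σ * (2 * 2 ^ r)   ≡⟨ regroup (expected (planesErrors T r p)) (2 ^ σ)
            (2 ^ r) ⟩
        2 * (expected (planesErrors T r p) * (2 ^ σ * 2 ^ r)) ≡⟨ cong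
            (λ k → 2 * (expected (planesErrors T r p) * k)) (^-distribˡ-+-* 2 σ r) ⟨
        2 * (expected (planesErrors T r p) * 2 ^ (σ + r))     ≤⟨ *-monoʳ-≤ 2 (planesErrors-rare T r p r≤) ⟩
        2 * (T * card H)                                    ∎)
      (go r (T + p) (m≤n⇒m≤1+n r≤)))
      where
      regroup : ∀ a b c → a * b * (2 * c) ≡ 2 * (a * (b * c))
      regroup = solve-∀

  attemptErrors-rare : ∀ r j → j + r ≡ ν →
                       expected (attemptErrors r j) * 2 ^ (σ + j) ≤ 2 * (T * card H)
  attemptErrors-rare r j j+r≡ν = begin
    expected (attemptErrors r j) * 2 ^ (σ + j)
      ≡⟨ cong (_* 2 ^ (σ + j)) (trans (∑-cong H (unfold r ∘ functions)) (∑-+ H _ _)) ⟩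
    (expected (planesErrors T j 0) + expected (rest r)) * 2 ^ (σ + j)
      ≡⟨ *-distribʳ-+ (2 ^ (σ + j)) (expected (planesErrors T j 0)) _ ⟩
    expected (planesErrors T j 0) * 2 ^ (σ + j) + expected (rest r) * 2 ^ (σ + j)
      ≤⟨ +-mono-≤ (planesErrors-rare T j 0 (≤-trans (m≤m+n j r) (≤-trans (≤-reflexive j+r≡ν) (m≤n+m ν (suc T)))))
          (rest-rare r j+r≡ν) ⟩
    T * card H + T * card H
      ≡⟨ cong (T * card H +_) (+-identityʳ _) ⟨
    2 * (T * card H) ∎
    where
    rest : ℕ → Functions → ℕ
    rest zero    = const 0
    rest (suc r) = attemptErrors r (suc j)
    unfold : ∀ r η → attemptErrors r j η ≡ planesErrors T j 0 η + rest r η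
    unfold zero    η = refl
    unfold (suc r) η = refl
    rest-rare : ∀ r → j + r ≡ ν → expected (rest r) * 2 ^ (σ + j) ≤ T * card H
    rest-rare zero    _     = ≤-trans (≤-reflexive (cong (_* 2 ^ (σ + j)) (∑-zero H))) z≤n
    rest-rare (suc r) j+r≡ν = *-cancelˡ-≤ 2 (begin
      2 * (expected (rest (suc r)) * 2 ^ (σ + j)) ≡⟨ swap (expected (rest (suc r))) (2 ^ (σ + j)) ⟩
      expected (rest (suc r)) * 2 ^ suc (σ + j)   ≡⟨ cong (λ k → expected (rest (suc r)) * 2 ^ k) (+-suc σ j) ⟨
      expected (rest (suc r)) * 2 ^ (σ + suc j)   ≤⟨ attemptErrors-rare r (suc j) (trans (sym (+-suc j r)) j+r≡ν) ⟩
      2 * (T * card H)                            ∎)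
      where
      swap : ∀ a b → 2 * (a * b) ≡ a * (2 * b)
      swap = solve-∀

  wrong-rare : Good → expected (λ η → wrong d (outputs (run ν 0 η) x y)) * 2 ^ σ ≤ 4 * (T * card H)
  wrong-rare good with attempt-correct good ν 0 refl
  ... | k , k≤ν , s = begin
    expected (λ η → wrong d (outputs (run ν 0 η) x y)) * 2 ^ σ
      ≤⟨ *-monoˡ-≤ (2 ^ σ) (∑-mono H (bounded ∘ functions)) ⟩
    expected (λ η → attemptErrors ν 0 η + finishErrors (level k) (1 * T) η) * 2 ^ σ
      ≡⟨ cong (_* 2 ^ σ) (∑-+ H _ _) ⟩
    (expected (attemptErrors ν 0) + expected (finishErrors (level k) (1 * T))) * 2 ^ σ
      ≡⟨ *-distribʳ-+ (2 ^ σ) (expected (attemptErrors ν 0)) _ ⟩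
    expected (attemptErrors ν 0) * 2 ^ σ + expected (finishErrors (level k) (1 * T)) * 2 ^ σ
      ≤⟨ +-mono-≤ (subst (λ s → expected (attemptErrors ν 0) * 2 ^ s ≤ 2 * (T * card H)) (+-identityʳ σ)
          (attemptErrors-rare ν 0 refl))
                  (finishErrors-rare (level k) (1 * T) (s≤s (m≤n⇒m≤1+n (+-monoʳ-≤ T k≤ν)))) ⟩
    2 * (T * card H) + 2 * (T * card H)
      ≡⟨ four (T * card H) ⟩
    4 * (T * card H) ∎
    where
    four : ∀ a → 2 * a + 2 * a ≡ 4 * a
    four = solve-∀
    bounded : ∀ η → wrong d (outputs (run ν 0 η) x y) ≤ attemptErrors ν 0 η + finishErrors (level k) (1 * T) η
    bounded η with _↝[_]_.acts s η
    ... | inj₁ err = ≤-trans (bit≤1 _) err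
    ... | inj₂ eq  = ≤-trans (≤-reflexive (trans (cong (wrong d) eq) (wrong-correct d))) z≤n

-- Letter hashes that miss too many mismatches

module LetterErrors (letterRows size : ℕ) where

  L : Summation (Table letterRows size)
  L = overTables letterRows size

  undetected-rare : ∀ {n} p → p ≤ letterRows → (xs ys : Vec ℕ n) → All (_< size) xs → All (_< size) ys →
                    ∑ L (λ t → undetected (functions t) p xs ys) * 2 ^ p ≤ distinct xs ys * card L
  undetected-rare p p≤ []       []       []          []          = ≤-reflexive (cong (_* 2 ^ p) (∑-zero L))
  undetected-rare p p≤ (x ∷ xs) (y ∷ ys) (x< ∷ xs<) (y< ∷ ys<) = begin
    ∑ L (λ t → undetected (functions t) p (x ∷ xs) (y ∷ ys)) * 2 ^ p
      ≡⟨ cong (_* 2 ^ p) (∑-+ L _ _) ⟩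
    (∑ L (λ t → letter (functions t)) + ∑ L (λ t → undetected (functions t) p xs ys)) * 2 ^ p
      ≡⟨ *-distribʳ-+ (2 ^ p) (∑ L (λ t → letter (functions t))) _ ⟩
    ∑ L (λ t → letter (functions t)) * 2 ^ p + ∑ L (λ t → undetected (functions t) p xs ys) * 2 ^ p
      ≤⟨ +-mono-≤ (letter-rare (x ≟ⁿ y)) (undetected-rare p p≤ xs ys xs< ys<) ⟩
    bit (not (does (x ≟ⁿ y))) * card L + distinct xs ys * card L
      ≡⟨ *-distribʳ-+ (card L) (bit (not (does (x ≟ⁿ y)))) _ ⟨
    distinct (x ∷ xs) (y ∷ ys) * card L ∎
    where
    open ≤-Reasoning
    letter : Functions → ℕ
    letter ρ = bit (not (does (x ≟ⁿ y)) ∧ agree ρ p x y)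
    letter-rare : (x≟y : Dec (x ≡ y)) →
      ∑ L (λ t → bit (not (does x≟y) ∧ agree (functions t) p x y)) * 2 ^ p ≤ bit (not (does x≟y)) * card L
    letter-rare (yes _)  = ≤-reflexive (cong (_* 2 ^ p) (∑-zero L))
    letter-rare (no x≢y) = ≤-reflexive (trans (collision p p≤ x< y< x≢y) (sym (+-identityʳ _)))

  module _ {n} (xs ys : Vec ℕ n) (xs< : All (_< size) xs) (ys< : All (_< size) ys)
           (T T′ : ℕ) (T≡ : T ≡ 2 + T′) where
    open ≤-Reasoning

    d : ℕ
    d = distinct xs ys

    tooMany? : ∀ ρ g → Dec (d < 2 ^ g * undetected ρ (g * T) xs ys)
    tooMany? ρ g = d <? 2 ^ g * undetected ρ (g * T) xs ys

    excess : ℕ → Functions → ℕ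
    excess g ρ = bit (does (tooMany? ρ g))

    letterErrors : ℕ → Functions → ℕ
    letterErrors G ρ = ∑< G (λ g → excess (suc g) ρ)

    no-letterErrors : ∀ G ρ → letterErrors G ρ ≡ 0 → ∀ g → g ≤ G → 2 ^ g * undetected ρ (g * T) xs ys ≤ d
    no-letterErrors G ρ none zero _ = ≤-trans (≤-reflexive (*-identityˡ _))
      (≤-trans (m≤n+m _ _) (≤-reflexive (detected+undetected ρ 0 xs ys)))
    no-letterErrors (suc G) ρ none (suc g) (s≤s g≤G) with g ≟ⁿ G
    ... | no g≢G   = no-letterErrors G ρ (m+n≡0⇒n≡0 (excess (suc G) ρ) none) (suc g) (≤∧≢⇒< g≤G g≢G)
    ... | yes refl = ≮⇒≥ λ d< → 1+n≢0 (trans (cong bit (sym (dec-true (tooMany? ρ (suc G)) d<)))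
                                             (m+n≡0⇒m≡0 (excess (suc G) ρ) none))

    -- Markov's inequality for an expectation of at most d / 2 ^ (g T), with g the stage number. Of
    -- the exponent g T ≥ 2 g + T′, one g pays for the threshold d / 2 ^ g, the other makes the sum
    -- over all stages converge, and T′ is the remaining safety margin. The event means at least d +
    -- 1, so dividing by `suc d` is safe even for d = 0.
    excess-rare : ∀ g → suc g * T ≤ letterRows →
                  ∑ L (λ t → excess (suc g) (functions t)) * 2 ^ T′ * 2 ^ suc g ≤ card L
    excess-rare g rows = *-cancelʳ-≤ _ _ (suc d) (begin
      E * 2 ^ T′ * 2 ^ suc g * suc d
        ≡⟨ regroup E (2 ^ T′) (2 ^ suc g) (suc d) ⟩
      E * suc d * (2 ^ T′ * 2 ^ suc g)
        ≤⟨ *-monoˡ-≤ _ markov ⟩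
      2 ^ suc g * U * (2 ^ T′ * 2 ^ suc g)
        ≡⟨ regroup′ (2 ^ suc g) U (2 ^ T′) ⟩
      U * (2 ^ suc g * 2 ^ suc g * 2 ^ T′)
        ≡⟨ cong (U *_) (trans (cong (_* 2 ^ T′) (sym (^-distribˡ-+-* 2 (suc g) (suc g))))
            (sym (^-distribˡ-+-* 2 (suc g + suc g) T′))) ⟩
      U * 2 ^ (suc g + suc g + T′)
        ≤⟨ *-monoʳ-≤ U (^-monoʳ-≤ 2 exponents) ⟩
      U * 2 ^ (suc g * T)
        ≤⟨ undetected-rare (suc g * T) rows xs ys xs< ys< ⟩
      d * card L
        ≤⟨ *-monoˡ-≤ (card L) (n≤1+n d) ⟩
      suc d * card L
        ≡⟨ *-comm (suc d) (card L) ⟩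
      card L * suc d ∎)
      where
      E = ∑ L (λ t → excess (suc g) (functions t))
      U = ∑ L (λ t → undetected (functions t) (suc g * T) xs ys)
      regroup : ∀ a b c k → a * b * c * k ≡ a * k * (b * c)
      regroup = solve-∀
      regroup′ : ∀ a b c → a * b * (c * a) ≡ b * (a * a * c)
      regroup′ = solve-∀
      exponents : suc g + suc g + T′ ≤ suc g * T
      exponents = begin
        suc g + suc g + T′         ≤⟨ +-monoʳ-≤ (suc g + suc g) (m≤m+n T′ (g * T′)) ⟩
        suc g + suc g + suc g * T′ ≡⟨ expand (suc g) T′ ⟩
        suc g * (2 + T′)           ≡⟨ cong (suc g *_) T≡ ⟨
        suc g * T                  ∎
        where
        expand : ∀ a b → a + a + a * b ≡ a * (2 + b)
        expand = solve-∀
      markov : E * suc d ≤ 2 ^ suc g * U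
      markov = begin
        E * suc d                                             ≡⟨ ∑-*ʳ L _ (suc d) ⟨
        ∑ L (λ t → excess (suc g) (functions t) * suc d)      ≤⟨ ∑-mono L (pointwise ∘ functions) ⟩
        ∑ L (λ t → 2 ^ suc g * undetected (functions t) (suc g * T) xs ys) ≡⟨ ∑-* L (2 ^ suc g) _ ⟩
        2 ^ suc g * U                                         ∎
        where
        pointwise : ∀ ρ → excess (suc g) ρ * suc d ≤ 2 ^ suc g * undetected ρ (suc g * T) xs ys
        pointwise ρ = go (tooMany? ρ (suc g))
          where
          go : ∀ {m} (d<m? : Dec (d < m)) → bit (does d<m?) * suc d ≤ m
          go (yes d<m) = ≤-trans (≤-reflexive (*-identityˡ _)) d<m
          go (no _)    = z≤n

    letterErrors-rare : ∀ G → G * T ≤ letterRows → ∑ L (letterErrors G ∘ functions) * 2 ^ T′ ≤ card L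
    letterErrors-rare G rows = begin
      ∑ L (letterErrors G ∘ functions) * 2 ^ T′
        ≡⟨ exchange G ⟩
      ∑< G (λ g → ∑ L (λ t → excess (suc g) (functions t)) * 2 ^ T′)
        ≤⟨ ∑<-geometric G _ (λ g g<G → excess-rare g (≤-trans (*-monoˡ-≤ T g<G) rows)) ⟩
      card L ∎
      where
      exchange : ∀ G → ∑ L (letterErrors G ∘ functions) * 2 ^ T′ ≡
                       ∑< G (λ g → ∑ L (λ t → excess (suc g) (functions t)) * 2 ^ T′)
      exchange zero    = cong (_* 2 ^ T′) (∑-zero L)
      exchange (suc G) = trans (cong (_* 2 ^ T′) (∑-+ L _ _))
        (trans (*-distribʳ-+ (2 ^ T′) (∑ L (λ t → excess (suc G) (functions t))) _)
            (cong (∑ L (λ t → excess (suc G) (functions t)) * 2 ^ T′ +_) (exchange G)))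

-- Decoding LZ77

module Decoding (Σ : Alphabet) where
  open Alphabet Σ using (Letter; _≟_)

  decodeFrom : List Letter → Encoding Σ → List Letter
  decodeFrom seen []                  = seen
  decodeFrom seen (triple s k c ∷ es) = decodeFrom (seen ++ take k (drop (s ∸ 1) seen) ++ c ∷ []) es

  lcp-≡ : ∀ {x y} xs ys → x ≡ y → lcp Σ (x ∷ xs) (y ∷ ys) ≡ suc (lcp Σ xs ys)
  lcp-≡ {x} {y} xs ys eq = cong (λ b → if b then suc (lcp Σ xs ys) else 0) (dec-true (x ≟ y) eq)

  lcp-≢ : ∀ {x y} xs ys → x ≢ y → lcp Σ (x ∷ xs) (y ∷ ys) ≡ 0
  lcp-≢ {x} {y} xs ys x≢y = cong (λ b → if b then suc (lcp Σ xs ys) else 0) (dec-false (x ≟ y) x≢y)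

  lcp-take : ∀ k xs ys → k ≤ lcp Σ xs ys →
             take k xs ≡ take k ys × lcp Σ (take k xs) ys ≡ length (take k xs)
  lcp-take zero    xs       ys       _ = refl , refl
  lcp-take (suc k) (x ∷ xs) (y ∷ ys) k≤ with x ≟ y
  ... | no  x≢y = contradiction (subst (suc k ≤_) (lcp-≢ xs ys x≢y) k≤) λ ()
  ... | yes x≡y with lcp-take k xs ys (s≤s⁻¹ (subst (suc k ≤_) (lcp-≡ xs ys x≡y) k≤))
  ...   | eq , len = cong₂ _∷_ x≡y eq , trans (lcp-≡ (take k xs) ys x≡y) (cong suc len)

  ≤-maximum : ∀ {A : Set} (f : A → ℕ) k ts → k ≤ foldr _⊔_ 0 (List.map f ts) → k ≡ 0 ⊎ ∃[ t ] t ∈ ts × k ≤ f t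
  ≤-maximum f zero    ts       _  = inj₁ refl
  ≤-maximum f (suc k) (t ∷ ts) k≤ with suc k ≤? f t
  ... | yes k≤ft = inj₂ (t , here refl , k≤ft)
  ... | no  k≰ft with ⊔-sel (f t) (foldr _⊔_ 0 (List.map f ts))
  ...   | inj₁ eq = contradiction (subst (suc k ≤_) eq k≤) k≰ft
  ...   | inj₂ eq with ≤-maximum f (suc k) ts (subst (suc k ≤_) eq k≤)
  ...     | inj₂ (t′ , t′∈ , k≤ft′) = inj₂ (t′ , there t′∈ , k≤ft′)

  leftmost-here : ∀ w c cs → lcp Σ w (c ∷ cs) ≡ length w → leftmost Σ w (c ∷ cs) ≡ 1
  leftmost-here w c cs eq = cong (λ b → if b then 1 else suc (leftmost Σ w cs))
      (dec-true (lcp Σ w (c ∷ cs) ≟ⁿ length w) eq)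

  leftmost-there : ∀ w c cs → lcp Σ w (c ∷ cs) ≢ length w → leftmost Σ w (c ∷ cs) ≡ suc (leftmost Σ w cs)
  leftmost-there w c cs ≢len =
    cong (λ b → if b then 1 else suc (leftmost Σ w cs)) (dec-false (lcp Σ w (c ∷ cs) ≟ⁿ length w) ≢len)

  1≤leftmost : ∀ w s → 1 ≤ leftmost Σ w s
  1≤leftmost w []       = ≤-refl
  1≤leftmost w (c ∷ cs) with lcp Σ w (c ∷ cs) ≟ⁿ length w
  ... | yes eq = ≤-reflexive (sym (leftmost-here w c cs eq))
  ... | no  ≢len = ≤-trans (s≤s z≤n) (≤-reflexive (sym (leftmost-there w c cs ≢len)))

  full-lcp : ∀ w s → lcp Σ w s ≡ length w → take (length w) s ≡ w
  full-lcp w s eq = trans (sym (proj₁ (lcp-take (length w) w s (≤-reflexive (sym eq)))))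
      (take-all (length w) w ≤-refl)

  -- The tail t only guarantees that the scan stops at an occurrence; the letters are copied from
  -- the first one, which may be a different tail.
  copy-leftmost : ∀ w s {t} → t ∈ tails s → lcp Σ w t ≡ length w →
                  take (length w) (drop (leftmost Σ w s ∸ 1) s) ≡ w
  copy-leftmost w []       (here refl) eq = full-lcp w [] eq
  copy-leftmost w (c ∷ cs) t∈ eq with lcp Σ w (c ∷ cs) ≟ⁿ length w
  ... | yes occurs = trans (cong (λ l → take (length w) (drop (l ∸ 1) (c ∷ cs))) (leftmost-here w c cs occurs))
                           (full-lcp w (c ∷ cs) occurs)
  copy-leftmost w (c ∷ cs) (here refl) eq | no ¬occurs = contradiction eq ¬occurs
  copy-leftmost w (c ∷ cs) (there t∈)  eq | no ¬occurs =
    trans (cong (λ l → take (length w) (drop (l ∸ 1) (c ∷ cs))) (leftmost-there w c cs ¬occurs))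
          (shifted (leftmost Σ w cs) (1≤leftmost w cs) (copy-leftmost w cs t∈ eq))
    where
    shifted : ∀ l → 1 ≤ l → take (length w) (drop (l ∸ 1) cs) ≡ w → take (length w) (drop l (c ∷ cs)) ≡ w
    shifted (suc l) _ eq = eq

  take-init : ∀ (f : List⁺ Letter) → take (List⁺.length f ∸ 1) (List⁺.toList f) ++ List⁺.last f ∷ [] ≡ List⁺.toList f
  take-init (x ∷ xs) with List.initLast xs
  ... | []       = refl
  ... | ys List.∷ʳ′ y = begin
    take (length (ys ++ y ∷ [])) (x ∷ ys ++ y ∷ []) ++ y ∷ []
      ≡⟨ cong (λ m → take m (x ∷ ys ++ y ∷ []) ++ y ∷ []) (trans (length-++ ys) (+-comm (length ys) 1)) ⟩
    x ∷ take (length ys) (ys ++ y ∷ []) ++ y ∷ []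
      ≡⟨ cong (λ zs → x ∷ zs ++ y ∷ []) (init ys) ⟩
    x ∷ ys ++ y ∷ [] ∎
    where
    open ≡-Reasoning
    init : ∀ ys {zs} → take (length ys) (ys ++ zs) ≡ ys
    init []       = refl
    init (y ∷ ys) = cong (y ∷_) (init ys)

  -- Here k equals p unless the word ends first, as for a last factor that occurs as a whole. In
  -- either case k ≤ p, so if k is positive some tail of `seen` shares its first k letters with the
  -- rest.
  copied-factor : ∀ seen c cs → let p = longestPrevious Σ seen (c ∷ cs)
                                    k = length (take p cs)
                                    v = take k (c ∷ take p cs) in
                  take k (drop (leftmost Σ v seen ∸ 1) seen) ≡ v
  copied-factor seen c cs = copies
    where
    p = longestPrevious Σ seen (c ∷ cs)
    k = length (take p cs)
    v = take k (c ∷ take p cs)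
    k≤p : k ≤ p
    k≤p = ≤-trans (≤-reflexive (length-take p cs)) (m⊓n≤m p _)
    v≡ : v ≡ take k (c ∷ cs)
    v≡ = trans (take-take k (suc p) (c ∷ cs)) (cong (λ m → take m (c ∷ cs)) (m≤n⇒m⊓n≡m (m≤n⇒m≤1+n k≤p)))
    |v|≡k : length v ≡ k
    |v|≡k = trans (length-take k (c ∷ take p cs)) (m≤n⇒m⊓n≡m (n≤1+n k))
    copies : take k (drop (leftmost Σ v seen ∸ 1) seen) ≡ v
    copies with ≤-maximum (lcp Σ (c ∷ cs)) k (tails seen) k≤p
    ... | inj₁ k≡0 = trans (cong (λ m → take m (drop (leftmost Σ v seen ∸ 1) seen)) k≡0)
                           (sym (cong (λ m → take m (c ∷ take p cs)) k≡0))
    ... | inj₂ (t , t∈ , k≤lcp) = subst (λ m → take m (drop (leftmost Σ v seen ∸ 1) seen) ≡ v) |v|≡k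
            (copy-leftmost v seen t∈ (subst (λ w → lcp Σ w t ≡ length w) (sym v≡)
                (proj₂ (lcp-take k (c ∷ cs) t k≤lcp))))

  decode-encode : ∀ fuel seen rest → length rest ≤ fuel →
                  decodeFrom seen (encode Σ seen (factorsFrom Σ fuel seen rest)) ≡ seen ++ rest
  decode-encode zero    seen []       _ = sym (++-identityʳ seen)
  decode-encode (suc m) seen []       _ = sym (++-identityʳ seen)
  decode-encode (suc m) seen (c ∷ cs) (s≤s len) = begin
    decodeFrom (seen ++ take k (drop (leftmost Σ (take k w) seen ∸ 1) seen) ++ List⁺.last (c ∷ take p cs) ∷ []) es
      ≡⟨ cong (λ u → decodeFrom (seen ++ u) es)
          (trans (cong (_++ List⁺.last (c ∷ take p cs) ∷ []) (copied-factor seen c cs)) (take-init (c ∷ take p cs))) ⟩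
    decodeFrom (seen ++ w) es
      ≡⟨ decode-encode m (seen ++ w) (drop p cs)
          (≤-trans (≤-trans (≤-reflexive (length-drop p cs)) (m∸n≤m _ p)) len) ⟩
    (seen ++ w) ++ drop p cs
      ≡⟨ ++-assoc seen w (drop p cs) ⟩
    seen ++ c ∷ take p cs ++ drop p cs
      ≡⟨ cong (λ u → seen ++ c ∷ u) (take++drop≡id p cs) ⟩
    seen ++ c ∷ cs ∎
    where
    open ≡-Reasoning
    p = longestPrevious Σ seen (c ∷ cs)
    w = c ∷ take p cs
    k = length (take p cs)
    es = encode Σ (seen ++ w) (factorsFrom Σ m (seen ++ w) (drop p cs))

-- Words as vectors of numbers, mismatching positions, and padding

fit : ∀ n → List ℕ → Vec ℕ n
fit zero    _        = []
fit (suc n) []       = 0 ∷ fit n []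
fit (suc n) (x ∷ xs) = x ∷ fit n xs

fit-toList : ∀ {A : Set} (f : A → ℕ) {n} (v : Vec A n) → fit n (List.map f (toList v)) ≡ Vec.map f v
fit-toList f []      = refl
fit-toList f (x ∷ v) = cong (f x ∷_) (fit-toList f v)

module Words (Σ : Alphabet) where
  open Alphabet Σ using (Letter; size; enumeration; _≟_)
  open Decoding Σ

  number : Letter → ℕ
  number = toℕ ∘ Inverse.to enumeration

  number-injective : ∀ {x y} → number x ≡ number y → x ≡ y
  number-injective {x} {y} eq = trans (sym (Inverse.strictlyInverseʳ enumeration x))
    (trans (cong (Inverse.from enumeration) (toℕ-injective eq)) (Inverse.strictlyInverseʳ enumeration y))

  numbers : ∀ {n} → Word Σ n → Vec ℕ n
  numbers = Vec.map number

  numbers<size : ∀ {n} (A : Word Σ n) → All (_< size) (numbers A)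
  numbers<size []      = []
  numbers<size (x ∷ A) = toℕ<n (Inverse.to enumeration x) ∷ numbers<size A

  -- Has to be defined for every list of triples; cutting or filling up by `fit` changes nothing for
  -- the encoding of a word of length n.
  decode : ∀ n → Encoding Σ → Vec ℕ n
  decode n e = fit n (List.map number (decodeFrom [] e))

  decode-LZN : ∀ {n} (A : Word Σ n) → decode n (LZN Σ A) ≡ numbers A
  decode-LZN {n} A = trans
    (cong (fit n ∘ List.map number) (decode-encode n [] (toList A) (≤-reflexive (length-toList A))))
    (fit-toList number A)

  positions : ∀ {m} → ℕ → Word Σ m → Word Σ m → List ℕ
  positions k []      []      = []
  positions k (x ∷ A) (y ∷ B) = if does (x ≟ y) then positions (suc k) A B else k ∷ positions (suc k) A B

  positions-≡ : ∀ {m} k {x y} (A B : Word Σ m) → x ≡ y → positions k (x ∷ A) (y ∷ B) ≡ positions (suc k) A B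
  positions-≡ k {x} {y} A B x≡y =
    cong (λ b → if b then positions (suc k) A B else k ∷ positions (suc k) A B) (dec-true (x ≟ y) x≡y)

  positions-≢ : ∀ {m} k {x y} (A B : Word Σ m) → x ≢ y → positions k (x ∷ A) (y ∷ B) ≡ k ∷ positions (suc k) A B
  positions-≢ k {x} {y} A B x≢y =
    cong (λ b → if b then positions (suc k) A B else k ∷ positions (suc k) A B) (dec-false (x ≟ y) x≢y)

  mismatches-positions : ∀ {n} (A B : Word Σ n) → List.map toℕ (mismatches Σ A B) ≡ positions 0 A B
  mismatches-positions {n} A B = go id 0 A B (λ _ → refl) (λ _ → refl) (λ _ → refl)
    where
    mismatch? : ∀ i → Dec (lookup A i ≢ lookup B i)
    mismatch? i = ¬? (lookup A i ≟ lookup B i)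

    -- The recursion runs over suffixes C and D of the words; f embeds their positions, shifted by
    -- k.
    go : ∀ {m} (f : Fin m → Fin n) k (C D : Word Σ m) → (∀ j → toℕ (f j) ≡ k + toℕ j) →
         (∀ j → lookup A (f j) ≡ lookup C j) → (∀ j → lookup B (f j) ≡ lookup D j) →
         List.map toℕ (filter mismatch? (List.tabulate f)) ≡ positions k C D
    go f k []      []      _ _ _ = refl
    go f k (x ∷ C) (y ∷ D) f≡ A≡ B≡ with x ≟ y | go (f ∘ suc) (suc k) C D
        (λ j → trans (f≡ (suc j)) (+-suc k (toℕ j))) (A≡ ∘ suc) (B≡ ∘ suc)
    ... | yes x≡y | ih = trans (cong (List.map toℕ)
        (filter-reject mismatch? λ differ → differ (trans (A≡ zero) (trans x≡y (sym (B≡ zero))))))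
                               (trans ih (sym (positions-≡ k C D x≡y)))
    ... | no  x≢y | ih = trans (cong (List.map toℕ)
        (filter-accept mismatch? λ same → x≢y (trans (sym (A≡ zero)) (trans same (B≡ zero)))))
                               (trans (cong₂ _∷_ (trans (f≡ zero) (+-identityʳ k)) ih) (sym (positions-≢ k C D x≢y)))

  dH-positions : ∀ {n} (A B : Word Σ n) → dH Σ A B ≡ length (positions 0 A B)
  dH-positions A B = trans (sym (length-map toℕ (mismatches Σ A B))) (cong length (mismatches-positions A B))

  length-positions : ∀ {m} k (A B : Word Σ m) → length (positions k A B) ≡ distinct (numbers A) (numbers B)
  length-positions k []      []      = refl
  length-positions k (x ∷ A) (y ∷ B) with x ≟ y
  ... | yes x≡y = trans (cong length (positions-≡ k A B x≡y)) (trans (length-positions (suc k) A B)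
    (cong (λ b → bit (not b) + distinct (numbers A) (numbers B))
        (sym (dec-true (number x ≟ⁿ number y) (cong number x≡y)))))
  ... | no  x≢y = trans (cong length (positions-≢ k A B x≢y)) (trans (cong suc (length-positions (suc k) A B))
    (cong (λ b → bit (not b) + distinct (numbers A) (numbers B))
        (sym (dec-false (number x ≟ⁿ number y) (x≢y ∘ number-injective)))))

  dH-distinct : ∀ {n} (A B : Word Σ n) → dH Σ A B ≡ distinct (numbers A) (numbers B)
  dH-distinct A B = trans (dH-positions A B) (length-positions 0 A B)

  widest : List ℕ → ℕ
  widest is = foldr _⊔_ 1 (gaps is)

  -- i is the last mismatch before the position k.
  end≤ : ∀ {m} i k (A B : Word Σ (suc m)) {ℓ} → Vec.last A ≢ Vec.last B → widest (i ∷ positions k A B) ≤ ℓ →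
         k + suc m ≤ suc i + length (positions k A B) * ℓ
  end≤-from : ∀ {m} k {x y} (A B : Word Σ m) {ℓ} → Vec.last (x ∷ A) ≢ Vec.last (y ∷ B) →
              widest (k ∷ positions (suc k) A B) ≤ ℓ →
              suc k + m ≤ suc k + length (positions (suc k) A B) * ℓ
  end≤-from {zero}  k [] [] _     _  = ≤-refl
  end≤-from {suc m} k A  B  last≢ ≤ℓ = end≤ k (suc k) A B last≢ ≤ℓ
  end≤ {m} i k (x ∷ A) (y ∷ B) {ℓ} last≢ ≤ℓ with x ≟ y
  end≤ {zero}  i k (x ∷ []) (y ∷ []) {ℓ} last≢ ≤ℓ | yes x≡y = contradiction x≡y last≢
  end≤ {suc m} i k (x ∷ A)  (y ∷ B)  {ℓ} last≢ ≤ℓ | yes x≡y =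
    subst₂ (λ a ps → a ≤ suc i + length ps * ℓ) (sym (+-suc k (suc m))) (sym (positions-≡ k A B x≡y))
           (end≤ i (suc k) A B last≢ (subst (λ ps → widest (i ∷ ps) ≤ ℓ) (positions-≡ k A B x≡y) ≤ℓ))
  end≤ {m} i k (x ∷ A) (y ∷ B) {ℓ} last≢ ≤ℓ | no x≢y =
    subst (λ ps → k + suc m ≤ suc i + length ps * ℓ) (sym (positions-≢ k A B x≢y)) (begin
      k + suc m                                       ≡⟨ +-suc k m ⟩
      suc k + m                                       ≤⟨ end≤-from k A B last≢ (≤-trans (m≤n⊔m (k ∸ i + 1) _) ≤ℓ′) ⟩
      suc k + length (positions (suc k) A B) * ℓ      ≤⟨ +-monoˡ-≤ _ k<i+ℓ ⟩
      suc i + ℓ + length (positions (suc k) A B) * ℓ  ≡⟨ +-assoc (suc i) ℓ _ ⟩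
      suc i + (ℓ + length (positions (suc k) A B) * ℓ) ∎)
    where
    open ≤-Reasoning
    ≤ℓ′ : (k ∸ i + 1) ⊔ widest (k ∷ positions (suc k) A B) ≤ ℓ
    ≤ℓ′ = subst (λ ps → widest (i ∷ ps) ≤ ℓ) (positions-≢ k A B x≢y) ≤ℓ
    k<i+ℓ : suc k ≤ suc i + ℓ
    k<i+ℓ = s≤s (begin
      k               ≤⟨ m≤n+m∸n k i ⟩
      i + (k ∸ i)     ≤⟨ +-monoʳ-≤ i (≤-trans (m≤m+n (k ∸ i) 1) (≤-trans (m≤m⊔n _ _) ≤ℓ′)) ⟩
      i + ℓ           ∎)

  1≤widest : ∀ is → 1 ≤ widest is
  1≤widest []           = ≤-refl
  1≤widest (_ ∷ [])     = ≤-refl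
  1≤widest (_ ∷ j ∷ is) = ≤-trans (1≤widest (j ∷ is)) (m≤n⊔m _ _)

  -- The first and the last position are mismatches, so the distances between consecutive ones cover
  -- the whole word: n ≤ 1 + (d - 1) ℓ ≤ d ℓ.
  ends-differ : ∀ {n} (A B : Word Σ n) → EndsDiffer Σ A B → 1 ≤ dH Σ A B × n ≤ dH Σ A B * ℓmax Σ A B
  ends-differ {suc m} AA@(x ∷ A) BB@(y ∷ B) (x≢y , last≢) =
    subst₂ (λ d ℓ → 1 ≤ d × suc m ≤ d * ℓ)
           (sym (trans (dH-positions AA BB) (cong length first)))
           (sym (cong widest (trans (mismatches-positions AA BB) first)))
           (s≤s z≤n , ≤-trans (end≤-from 0 A B last≢ ≤-refl) (+-monoˡ-≤ _ (1≤widest (0 ∷ positions 1 A B))))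
    where
    first = positions-≢ 0 A B x≢y

-- The protocol runs on the words as they are; padding enters only through the bounds. D, ℓ and z
-- belong to the normalised pair, whereas n is the original length.
record Instance {Σ : Alphabet} {n} (A B : Word Σ n) : Set where
  field
    D ℓ z  : ℕ
    1≤D    : 1 ≤ D
    dH≤D   : dH Σ A B ≤ D
    n≤D*ℓ  : n ≤ D * ℓ
    rounds≡ : roundBound Σ A B ≡ D * lg z
    bits≡   : bitBound Σ A B ≡ D * lg ℓ

module _ (Σ : Alphabet) where
  open Alphabet Σ using (_≟_)
  open Alphabet (padded Σ) using () renaming (_≟_ to _≟′_)
  open Words
  open Decoding

  padded-positions : ∀ {m} k k′ (A B : Word Σ m) {x y} →
    length (positions Σ k A B) ≤ length (positions (padded Σ) k′ (Vec.map inj₁ A ∷ʳ x) (Vec.map inj₁ B ∷ʳ y))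
  padded-positions k k′ []      []      = z≤n
  padded-positions k k′ (a ∷ A) (b ∷ B) {x} {y} with a ≟ b
  ... | yes a≡b = subst₂ (λ ps qs → length ps ≤ length qs) (sym (positions-≡ Σ k A B a≡b))
                    (sym (positions-≡ (padded Σ) k′ {inj₁ a} {inj₁ b} (Vec.map inj₁ A ∷ʳ x) (Vec.map inj₁ B ∷ʳ y)
                        (cong inj₁ a≡b))) (padded-positions (suc k) (suc k′) A B)
  ... | no  a≢b = subst₂ (λ ps qs → length ps ≤ length qs) (sym (positions-≢ Σ k A B a≢b))
                    (sym (positions-≢ (padded Σ) k′ {inj₁ a} {inj₁ b} (Vec.map inj₁ A ∷ʳ x) (Vec.map inj₁ B ∷ʳ y)
                        (a≢b ∘ inj₁-injective))) (s≤s (padded-positions (suc k) (suc k′) A B))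

  padded-ends : ∀ {n} (A B : Word Σ n) → EndsDiffer (padded Σ) (padA Σ A) (padB Σ B)
  padded-ends A B = (λ ()) , λ last≡ → contradiction
    (trans (sym (last-∷ʳ (dollar Σ) (hash Σ ∷ Vec.map inj₁ A)))
        (trans last≡ (last-∷ʳ (hash Σ) (dollar Σ ∷ Vec.map inj₁ B)))) λ ()

  dH≤padded : ∀ {n} (A B : Word Σ n) → dH Σ A B ≤ dH (padded Σ) (padA Σ A) (padB Σ B)
  dH≤padded A B = subst₂ _≤_ (sym (dH-positions Σ A B))
    (sym (trans (dH-positions (padded Σ) (padA Σ A) (padB Σ B))
                (cong length (positions-≢ (padded Σ) 0 {hash Σ} {dollar Σ} (Vec.map inj₁ A ∷ʳ dollar Σ)
                    (Vec.map inj₁ B ∷ʳ hash Σ) λ ()))))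
    (m≤n⇒m≤1+n (padded-positions 0 1 A B))

  normalise : ∀ {n} (A B : Word Σ n) → Instance A B
  normalise {n} A B with endsDiffer? Σ A B in eq
  ... | yes ends = let 1≤d , n≤ = ends-differ Σ A B ends in record
    { D = dH Σ A B ; ℓ = ℓmax Σ A B ; z = zn Σ A ; 1≤D = 1≤d ; dH≤D = ≤-refl ; n≤D*ℓ = n≤
    ; rounds≡ = chosen _ ; bits≡ = chosen _ }
    where
    chosen : ∀ Q → normalised Σ Q A B ≡ Q Σ A B
    chosen Q rewrite eq = refl
  ... | no _ = let 1≤d , n≤ = ends-differ (padded Σ) (padA Σ A) (padB Σ B) (padded-ends A B) in record
    { D = dH (padded Σ) (padA Σ A) (padB Σ B) ; ℓ = ℓmax (padded Σ) (padA Σ A) (padB Σ B) ; z = zn (padded Σ)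
        (padA Σ A)
    ; 1≤D = 1≤d ; dH≤D = dH≤padded A B ; n≤D*ℓ = ≤-trans (m≤n+m n 2) n≤
    ; rounds≡ = chosen _ ; bits≡ = chosen _ }
    where
    chosen : ∀ Q → normalised Σ Q A B ≡ Q (padded Σ) (padA Σ A) (padB Σ B)
    chosen Q rewrite eq = refl

-- Rounds and bits

derun-∷ : ∀ p l → length (derun _≟ᴾ_ (p ∷ l)) ≤ suc (length (derun _≟ᴾ_ l))
derun-∷ p []      = ≤-refl
derun-∷ p (q ∷ l) with p ≟ᴾ q
... | yes _ = n≤1+n _
... | no  _ = ≤-refl

derun-replicate : ∀ k p l → length (derun _≟ᴾ_ (replicate k p ++ l)) ≤ suc (length (derun _≟ᴾ_ l))
derun-replicate zero          p l = n≤1+n _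
derun-replicate (suc zero)    p l = derun-∷ p l
derun-replicate (suc (suc k)) p l =
  ≤-trans (≤-reflexive (cong length (derun-reject _≟ᴾ_ (replicate k p ++ l) refl))) (derun-replicate (suc k) p l)

rounds-block : ∀ a b {q} l → a + b ≤ q →
               length (derun _≟ᴾ_ (replicate a alice ++ replicate b bob ++ l)) ≤ 2 + length (derun _≟ᴾ_ l)
rounds-block a b l _ = ≤-trans (derun-replicate a alice _) (s≤s (derun-replicate b bob l))

bits-block : ∀ a b {q} l → a + b ≤ q → length (replicate a alice ++ replicate b bob ++ l) ≤ q + length l
bits-block a b {q} l a+b≤q = begin
  length (replicate a alice ++ replicate b bob ++ l)  ≡⟨ length-++ (replicate a alice) ⟩
  length (replicate a alice) + length (replicate b bob ++ l)
    ≡⟨ cong₂ _+_ (length-replicate a)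
        (trans (length-++ (replicate b bob)) (cong (_+ length l) (length-replicate b))) ⟩
  a + (b + length l)                                  ≡⟨ +-assoc a b _ ⟨
  a + b + length l                                    ≤⟨ +-monoˡ-≤ _ a+b≤q ⟩
  q + length l                                        ∎
  where open ≤-Reasoning

∑<-const : ∀ n c → ∑< n (const c) ≡ n * c
∑<-const zero    c = refl
∑<-const (suc n) c = cong (c +_) (∑<-const n c)

module LevelCost (ν σ : ℕ) where
  open ≤-Reasoning

  planeBits : ℕ → ℕ
  planeBits = planeLength ν σ

  planeBits≤ : ∀ i → planeBits i ≤ 2 * (2 ^ i * (ν ∸ i + (5 + σ)))
  planeBits≤ i = begin
    codeLength ν i + σ * 2 ^ i + suc (codeLength ν i) ≡⟨ regroup (2 ^ i) (ν ∸ i) σ ⟩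
    1 + 2 ^ i * (2 * (ν ∸ i) + 4 + σ)                 ≤⟨ +-monoˡ-≤ _ (m^n>0 2 i) ⟩
    2 ^ i + 2 ^ i * (2 * (ν ∸ i) + 4 + σ)             ≤⟨ m≤m+n _ (2 ^ i * (5 + σ)) ⟩
    2 ^ i + 2 ^ i * (2 * (ν ∸ i) + 4 + σ) + 2 ^ i * (5 + σ) ≡⟨ collect (2 ^ i) (ν ∸ i) σ ⟩
    2 * (2 ^ i * (ν ∸ i + (5 + σ)))                   ∎
    where
    regroup : ∀ p r s → p * (r + 2) + s * p + suc (p * (r + 2)) ≡ 1 + p * (2 * r + 4 + s)
    regroup = solve-∀
    collect : ∀ p r s → p + p * (2 * r + 4 + s) + p * (5 + s) ≡ 2 * (p * (r + (5 + s)))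
    collect = solve-∀

  -- From r to r + 1 the power doubles and `ν ∸ r` drops by at most 1. The 7 is the fixed point of
  -- this recursion: the mean of 5 and 7, plus 1.
  levels≤ : ∀ r → ∑< r planeBits ≤ 2 * (2 ^ r * (ν ∸ r + (7 + σ)))
  levels≤ zero    = z≤n
  levels≤ (suc r) = begin
    planeBits r + ∑< r planeBits
      ≤⟨ +-mono-≤ (planeBits≤ r) (levels≤ r) ⟩
    2 * (2 ^ r * (ν ∸ r + (5 + σ))) + 2 * (2 ^ r * (ν ∸ r + (7 + σ)))
      ≡⟨ merge (2 ^ r) (ν ∸ r) σ ⟩
    2 * (2 * 2 ^ r * (ν ∸ r + (6 + σ)))
      ≤⟨ *-monoʳ-≤ 2 (*-monoʳ-≤ (2 ^ suc r) (begin
           ν ∸ r + (6 + σ)             ≤⟨ +-monoˡ-≤ (6 + σ) next ⟩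
           suc (ν ∸ suc r) + (6 + σ)   ≡⟨ +-suc (ν ∸ suc r) (6 + σ) ⟨
           ν ∸ suc r + (7 + σ)         ∎)) ⟩
    2 * (2 ^ suc r * (ν ∸ suc r + (7 + σ))) ∎
    where
    merge : ∀ p r s → 2 * (p * (r + (5 + s))) + 2 * (p * (r + (7 + s))) ≡ 2 * (2 * p * (r + (6 + s)))
    merge = solve-∀
    next : ν ∸ r ≤ suc (ν ∸ suc r)
    next = m≤n+o⇒m∸n≤o ν r (subst (ν ≤_) (sym (+-suc r (ν ∸ suc r))) (m≤n+m∸n ν (suc r)))

  -- Going j levels beyond k costs a factor 2 ^ j only. It is used with j = 0 for the doubling and
  -- with j = T for the halving phase.
  levels-above : ∀ k j → ∑< (suc (j + k)) planeBits ≤ 4 * 2 ^ j * (2 ^ k * (ν ∸ k + (7 + σ)))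
  levels-above k j = begin
    ∑< (suc (j + k)) planeBits
      ≤⟨ levels≤ (suc (j + k)) ⟩
    2 * (2 ^ suc (j + k) * (ν ∸ suc (j + k) + (7 + σ)))
      ≤⟨ *-monoʳ-≤ 2 (*-monoʳ-≤ (2 ^ suc (j + k)) (+-monoˡ-≤ (7 + σ) (∸-monoʳ-≤ ν (≤-trans (m≤n+m k j) (n≤1+n _))))) ⟩
    2 * (2 * 2 ^ (j + k) * (ν ∸ k + (7 + σ)))
      ≡⟨ cong (λ p → 2 * (2 * p * (ν ∸ k + (7 + σ)))) (^-distribˡ-+-* 2 j k) ⟩
    2 * (2 * (2 ^ j * 2 ^ k) * (ν ∸ k + (7 + σ)))
      ≡⟨ regroup (2 ^ j) (2 ^ k) _ ⟩
    4 * 2 ^ j * (2 ^ k * (ν ∸ k + (7 + σ))) ∎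
    where
    regroup : ∀ a b c → 2 * (2 * (a * b) * c) ≡ 4 * a * (b * c)
    regroup = solve-∀

1≤lg : ∀ z → 1 ≤ lg z
1≤lg z = m≤m⊔n 1 ⌈log₂ z ⌉

-- By n ≤ D ℓ, log (n/2ᵏ) ≤ log ℓ + log (D/2ᵏ), and 2ᵏ log (D/2ᵏ) = O(D) because m ≤ 2ᵐ.
level-size : ∀ n D ℓ a k → 1 ≤ D → n ≤ D * ℓ → 2 ^ k ≤ 2 * D →
             2 ^ k * (⌈log₂ n ⌉ ∸ k + a) ≤ (4 + 2 * a) * (D * lg ℓ)
level-size n D ℓ a k 1≤D n≤Dℓ 2^k≤2D = begin
  2 ^ k * (⌈log₂ n ⌉ ∸ k + a)                    ≤⟨ *-monoʳ-≤ (2 ^ k) (+-monoˡ-≤ a logs) ⟩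
  2 ^ k * (lg ℓ + (δ ∸ k) + a)                   ≡⟨ regroup (2 ^ k) (lg ℓ) (δ ∸ k) a ⟩
  2 ^ k * (lg ℓ + a) + 2 ^ k * (δ ∸ k)           ≤⟨ +-mono-≤ (*-mono-≤ 2^k≤2D (+-monoʳ-≤ (lg ℓ) (m≤m*lg a)))
      (≤-trans (product-bound k δ) (2^⌈log₂n⌉≤2n D 1≤D)) ⟩
  2 * D * (lg ℓ + a * lg ℓ) + 2 * D              ≤⟨ +-monoʳ-≤ _ (m≤m*lg (2 * D)) ⟩
  2 * D * (lg ℓ + a * lg ℓ) + 2 * D * lg ℓ       ≡⟨ collect D (lg ℓ) a ⟩
  (4 + 2 * a) * (D * lg ℓ)                       ∎
  where
  open ≤-Reasoning
  δ = ⌈log₂ D ⌉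
  m≤m*lg : ∀ m → m ≤ m * lg ℓ
  m≤m*lg m = ≤-trans (≤-reflexive (sym (*-identityʳ m))) (*-monoʳ-≤ m (1≤lg ℓ))
  regroup : ∀ p l x a → p * (l + x + a) ≡ p * (l + a) + p * x
  regroup = solve-∀
  collect : ∀ D l a → 2 * D * (l + a * l) + 2 * D * l ≡ (4 + 2 * a) * (D * l)
  collect = solve-∀
  product-bound : ∀ k δ → 2 ^ k * (δ ∸ k) ≤ 2 ^ δ
  product-bound k δ with k ≤? δ
  ... | yes k≤δ = begin
    2 ^ k * (δ ∸ k)       ≤⟨ *-monoʳ-≤ (2 ^ k) (m≤2^m (δ ∸ k)) ⟩
    2 ^ k * 2 ^ (δ ∸ k)   ≡⟨ ^-distribˡ-+-* 2 k (δ ∸ k) ⟨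
    2 ^ (k + (δ ∸ k))     ≡⟨ cong (2 ^_) (m+[n∸m]≡n k≤δ) ⟩
    2 ^ δ                 ∎
  ... | no k≰δ = ≤-trans (≤-reflexive (trans (cong (2 ^ k *_) (m≤n⇒m∸n≡0 (<⇒≤ (≰⇒> k≰δ)))) (*-zeroʳ (2 ^ k)))) z≤n
  logs : ⌈log₂ n ⌉ ∸ k ≤ lg ℓ + (δ ∸ k)
  logs = m≤n+o⇒m∸n≤o _ k (begin
    ⌈log₂ n ⌉                      ≤⟨ ⌈log₂⌉-mono-≤ (begin
      n                              ≤⟨ n≤Dℓ ⟩
      D * ℓ                          ≤⟨ *-mono-≤ (n≤2^⌈log₂n⌉ D)
          (≤-trans (n≤2^⌈log₂n⌉ ℓ) (^-monoʳ-≤ 2 (m≤n⊔m 1 ⌈log₂ ℓ ⌉))) ⟩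
      2 ^ δ * 2 ^ lg ℓ               ≡⟨ ^-distribˡ-+-* 2 δ (lg ℓ) ⟨
      2 ^ (δ + lg ℓ)                 ∎) ⟩
    ⌈log₂ 2 ^ (δ + lg ℓ) ⌉         ≡⟨ ⌈log₂2^n⌉≡n (δ + lg ℓ) ⟩
    δ + lg ℓ                       ≤⟨ +-monoˡ-≤ (lg ℓ) (m≤n+m∸n δ k) ⟩
    k + (δ ∸ k) + lg ℓ             ≡⟨ reorder k (δ ∸ k) (lg ℓ) ⟩
    k + (lg ℓ + (δ ∸ k))           ∎)
    where
    reorder : ∀ a b c → a + b + c ≡ a + (c + b)
    reorder = solve-∀

-- Public coins

prefix : ∀ m → Coins → Vec Bool m
prefix zero    ω = []
prefix (suc m) ω = ω 0 ∷ prefix m (ω ∘ suc)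

prefix-local : ∀ m ω ω′ → (∀ i → i < m → ω i ≡ ω′ i) → prefix m ω ≡ prefix m ω′
prefix-local zero    ω ω′ _   = refl
prefix-local (suc m) ω ω′ eq = cong₂ _∷_ (eq 0 (s≤s z≤n)) (prefix-local m _ _ λ i i<m → eq (suc i) (s≤s i<m))

prefix-prepend : ∀ {m} (w : Vec Bool m) ω → prefix m (prepend w ω) ≡ w
prefix-prepend []      ω = refl
prefix-prepend (b ∷ w) ω = cong (b ∷_) (prefix-prepend w ω)

count-∑ : ∀ m (E : Vec Bool m → Bool) → count m E ≡ ∑ (overBits m) (bit ∘ E)
count-∑ zero    E = refl
count-∑ (suc m) E = cong₂ _+_ (count-∑ m (E ∘ (false ∷_))) (count-∑ m (E ∘ (true ∷_)))

-- A positive ε has numerator at least 1, so it is at least the reciprocal of its denominator, which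
-- bounds the failure rate b / N.
1-ε≤ : ∀ ε → 0ℚ <ℚ ε → ∀ c b N .{{_ : NonZero N}} → c + b ≡ N → b * ℚ.↧ₙ ε ≤ N → 1ℚ - ε ℚ.≤ (ℤ.+ c) ℚ./ N
1-ε≤ (mkℚ (ℤ.+ zero)  _ _)      (ℚ.*<* (ℤ.+<+ ()))
1-ε≤ (mkℚ ℤ.-[1+ _ ]  _ _)      (ℚ.*<* ())
1-ε≤ ε@(mkℚ (ℤ.+ suc a) q-1 _) _ c b N@(suc k) c+b≡N bq≤N = begin
  1ℚ - ε               ≤⟨ ℚ.+-monoˡ-≤ (ℚ.- ε) 1≤f+ε ⟩
  f ℚ.+ ε ℚ.- ε        ≡⟨ ℚ.+-assoc f ε (ℚ.- ε) ⟩
  f ℚ.+ (ε ℚ.- ε)      ≡⟨ cong (f ℚ.+_) (ℚ.+-inverseʳ ε) ⟩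
  f ℚ.+ 0ℚ             ≡⟨ ℚ.+-identityʳ f ⟩
  f                    ∎
  where
  open ℚ.≤-Reasoning
  q = suc q-1
  f = (ℤ.+ c) ℚ./ N
  numerators : 1 * (N * q) ≤ (c * q + suc a * N) * 1
  numerators = ≤-trans (≤-reflexive
      (trans (*-identityˡ (N * q)) (trans (cong (_* q) (sym c+b≡N)) (*-distribʳ-+ q c b))))
    (≤-trans (+-monoʳ-≤ (c * q) (≤-trans bq≤N (m≤n*m N (suc a)))) (≤-reflexive (sym (*-identityʳ _))))
  sum≡ : ℤ.+ ((c * q + suc a * N) * 1) ≡ ((ℤ.+ c) ℤ.* (ℤ.+ q) ℤ.+ (ℤ.+ suc a) ℤ.* (ℤ.+ N)) ℤ.* (ℤ.+ 1)
  sum≡ = trans (ℤ.pos-* (c * q + suc a * N) 1) (cong (ℤ._* (ℤ.+ 1))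
    (trans (ℤ.pos-+ (c * q) (suc a * N)) (cong₂ ℤ._+_ (ℤ.pos-* c q) (ℤ.pos-* (suc a) N))))
  1≤f+ε : 1ℚ ℚ.≤ f ℚ.+ ε
  1≤f+ε = ℚ.toℚᵘ-cancel-≤ (ℚᵘ.≤-trans (*≤* (subst₂ ℤ._≤_ (ℤ.pos-* 1 (N * q)) sum≡ (ℤ.+≤+ numerators)))
    (ℚᵘ.≤-reflexive (ℚᵘ.≃-sym (ℚᵘ.≃-trans (ℚ.toℚᵘ-homo-+ f ε)
        (ℚᵘ.+-congˡ (ℚ.toℚᵘ ε) (ℚ.toℚᵘ-fromℚᵘ (mkℚᵘ (ℤ.+ c) k)))))))

-- Constants, the public-coin protocol, and its analysis

roundFactor : ℕ → ℕ
roundFactor T = T * (4 + (2 + T) * 2)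

bitFactor : ℕ → ℕ → ℕ
bitFactor T σ = T * (4 + 4 * 2 ^ T) * (4 + 2 * (7 + σ))

-- `T≡` makes bad letter hashes have probability at most 2 ^ (- (e + 1)). `σ≡` does the same for
-- fingerprint errors, whose probability is at most 4 T / 2 ^ σ ≤ 2 ^ (T + 2 - σ). Together they
-- leave 2 ^ (- e).
module Solution (e T σ : ℕ) (T≡ : T ≡ 2 + suc e) (σ≡ : σ ≡ T + 2 + suc e) (Σ : Alphabet) (n : ℕ) where
  open Alphabet Σ using (size)
  open Words Σ

  ν letterRows hashRows coins : ℕ
  ν          = ⌈log₂ n ⌉
  -- One stage of T planes shared by all attempts, and at most `suc (T + ν)` stages of halving.
  letterRows = suc (suc (T + ν)) * T
  hashRows   = 2 ^ suc (T + ν) * (ν + 2 + σ)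
  coins      = letterRows * size + hashRows * 2 ^ n

  open Game n ν (n≤2^⌈log₂n⌉ n) T σ (decode n) (decode n)

  tables : Vec Bool coins → Table letterRows size × Table hashRows (2 ^ n)
  tables w = toTable letterRows (proj₁ uv) , toTable hashRows (proj₂ uv)
    where uv = split (letterRows * size) w

  protocol : Table letterRows size × Table hashRows (2 ^ n) → Π
  protocol (t , t′) = Run.attempt (functions t) (functions t′) ν 0

  π : PublicCoinProtocol (Encoding Σ) (Encoding Σ) ℕ
  π ω = protocol (tables (prefix coins ω))

  L = overTables letterRows size
  H = overTables hashRows (2 ^ n)

  ∑-tables : ∀ f → ∑ (overBits coins) (f ∘ tables) ≡ ∑ L λ t → ∑ H λ t′ → f (t , t′)
  ∑-tables f = trans (∑-split (letterRows * size) λ (u , v) → f (toTable letterRows u , toTable hashRows v))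
    (trans (∑-toTable letterRows λ t → ∑ (overBits (hashRows * 2 ^ n)) λ v → f (t , toTable hashRows v))
           (∑-cong L λ t → ∑-toTable hashRows λ t′ → f (t , t′)))

  card-tables : card L * card H ≡ 2 ^ coins
  card-tables = begin
    card L * card H                     ≡⟨ *-comm (card L) (card H) ⟩
    card H * card L                     ≡⟨ ∑-const L (card H) ⟨
    ∑ L (λ _ → card H)                  ≡⟨ ∑-tables (const 1) ⟨
    card (overBits coins)               ≡⟨ card-overBits coins ⟩
    2 ^ coins                           ∎
    where open ≡-Reasoning

  enough-hashRows : ∀ i → i ≤ suc (T + ν) → hashLength ν σ i ≤ hashRows
  enough-hashRows i i≤ = begin
    2 ^ i * (ν ∸ i + 2) + σ * 2 ^ i        ≡⟨ regroup (2 ^ i) (ν ∸ i) σ ⟩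
    2 ^ i * (ν ∸ i + 2 + σ)                ≤⟨ *-mono-≤ (^-monoʳ-≤ 2 i≤) (+-monoˡ-≤ σ (+-monoˡ-≤ 2 (m∸n≤m ν i))) ⟩
    2 ^ suc (T + ν) * (ν + 2 + σ)          ∎
    where
    open ≤-Reasoning
    regroup : ∀ p r s → p * (r + 2) + s * p ≡ p * (r + 2 + s)
    regroup = solve-∀

  module _ (A B : Word Σ n) where
    x y : Encoding Σ
    x = LZN Σ A
    y = LZN Σ B

    xs ys : Vec ℕ n
    xs = decode n x
    ys = decode n y

    d : ℕ
    d = distinct xs ys

    d≡dH : d ≡ dH Σ A B
    d≡dH = trans (cong₂ distinct (decode-LZN A) (decode-LZN B)) (sym (dH-distinct A B))

    G : ℕ
    G = suc (suc (T + ν))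

    open LetterErrors letterRows size using (letterErrors; letterErrors-rare; no-letterErrors)

    lettersA = subst (All (_< size)) (sym (decode-LZN A)) (numbers<size A)
    lettersB = subst (All (_< size)) (sym (decode-LZN B)) (numbers<size B)

    1≤σ : 1 ≤ σ
    1≤σ = ≤-trans (s≤s z≤n) (≤-trans (m≤n+m (suc e) (T + 2)) (≤-reflexive (sym σ≡)))

    misses : Functions → ℕ
    misses = letterErrors xs ys lettersA lettersB T (suc e) T≡ G

    failure : Table letterRows size × Table hashRows (2 ^ n) → ℕ
    failure t = wrong d (outputs (protocol t) x y)

    -- Conditioning on the letter hashes: without misses they are `Good` and only fingerprints can
    -- fail; with a miss the second summand exceeds the trivial bound `card H`, scaled alike.
    failure-given-letters : ∀ t → ∑ H (λ t′ → failure (t , t′)) * 2 ^ suc e ≤ card H + misses (functions t) *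
        (card H * 2 ^ suc e)
    failure-given-letters t = go (misses (functions t)) refl
      where
      open ≤-Reasoning
      regroup : ∀ a h → 4 * (a * h) ≡ h * (a * 4)
      regroup = solve-∀
      E : ℕ
      E = ∑ H λ t′ → failure (t , t′)
      go : ∀ m → misses (functions t) ≡ m → E * 2 ^ suc e ≤ card H + m * (card H * 2 ^ suc e)
      go zero misses≡ = ≤-trans (*-cancelʳ-≤ _ _ (2 ^ (T + 2)) {{m^n≢0 2 (T + 2)}} (begin
        E * 2 ^ suc e * 2 ^ (T + 2)
          ≡⟨ trans (*-assoc E (2 ^ suc e) (2 ^ (T + 2)))
              (cong (E *_) (trans (*-comm (2 ^ suc e) _)
              (trans (sym (^-distribˡ-+-* 2 (T + 2) (suc e))) (cong (2 ^_) (sym σ≡))))) ⟩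
        E * 2 ^ σ
          ≤⟨ HashErrors.wrong-rare n ν (n≤2^⌈log₂n⌉ n) T σ 1≤σ (decode n) (decode n)
              (functions t) x y hashRows enough-hashRows
               (no-letterErrors xs ys lettersA lettersB T (suc e) T≡ G (functions t) misses≡) ⟩
        4 * (T * card H)
          ≤⟨ *-monoʳ-≤ 4 (*-monoˡ-≤ (card H) (m≤2^m T)) ⟩
        4 * (2 ^ T * card H)
          ≡⟨ regroup (2 ^ T) (card H) ⟩
        card H * (2 ^ T * 4)
          ≡⟨ cong (card H *_) (^-distribˡ-+-* 2 T 2) ⟨
        card H * 2 ^ (T + 2) ∎)) (m≤m+n (card H) 0)
      go (suc k) _ = begin
        E * 2 ^ suc e                              ≤⟨ *-monoˡ-≤ (2 ^ suc e) (∑-mono H {g = const 1} λ t′ → bit≤1 _) ⟩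
        card H * 2 ^ suc e                         ≤⟨ m≤m+n (card H * 2 ^ suc e) (k * (card H * 2 ^ suc e)) ⟩
        suc k * (card H * 2 ^ suc e)               ≤⟨ m≤n+m _ (card H) ⟩
        card H + suc k * (card H * 2 ^ suc e)      ∎

    failures : ℕ
    failures = ∑ (overBits coins) (failure ∘ tables)

    failures-rare : failures * 2 ^ e ≤ 2 ^ coins
    failures-rare = *-cancelˡ-≤ 2 (begin
      2 * (failures * 2 ^ e)
        ≡⟨ swap failures (2 ^ e) ⟩
      failures * 2 ^ suc e
        ≡⟨ cong (_* 2 ^ suc e) (∑-tables failure) ⟩
      ∑ L (λ t → ∑ H λ t′ → failure (t , t′)) * 2 ^ suc e
        ≡⟨ ∑-*ʳ L _ (2 ^ suc e) ⟨
      ∑ L (λ t → ∑ H (λ t′ → failure (t , t′)) * 2 ^ suc e)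
        ≤⟨ ∑-mono L failure-given-letters ⟩
      ∑ L (λ t → card H + misses (functions t) * (card H * 2 ^ suc e))
        ≡⟨ trans (∑-+ L _ _) (cong₂ _+_ (∑-const L (card H)) (∑-*ʳ L _ _)) ⟩
      card H * card L + ∑ L (misses ∘ functions) * (card H * 2 ^ suc e)
        ≡⟨ regroup (card H) (card L) (∑ L (misses ∘ functions)) (2 ^ suc e) ⟩
      card H * card L + card H * (∑ L (misses ∘ functions) * 2 ^ suc e)
        ≤⟨ +-monoʳ-≤ (card H * card L) (*-monoʳ-≤ (card H)
            (letterErrors-rare xs ys lettersA lettersB T (suc e) T≡ G ≤-refl)) ⟩
      card H * card L + card H * card L
        ≡⟨ double (card H) (card L) ⟩
      2 * (card L * card H)
        ≡⟨ cong (2 *_) card-tables ⟩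
      2 * 2 ^ coins ∎)
      where
      open ≤-Reasoning
      swap : ∀ a b → 2 * (a * b) ≡ a * (2 * b)
      swap = solve-∀
      regroup : ∀ h l m p → h * l + m * (h * p) ≡ h * l + h * (m * p)
      regroup = solve-∀
      double : ∀ h l → h * l + h * l ≡ 2 * (l * h)
      double = solve-∀

    correct : ∀ ε → 0ℚ <ℚ ε → ℚ.↧ₙ ε ≤ 2 ^ e → Pr[ Returns π x y (dH Σ A B) ]≥ (1ℚ - ε)
    correct ε 0<ε small = coins
      , (λ ω ω′ eq → cong (λ w → does (both? (dH Σ A B) (outputs (protocol (tables w)) x y)))
          (prefix-local coins ω ω′ eq))
      , 1-ε≤ ε 0<ε successes failures (2 ^ coins) {{m^n≢0 2 coins}} total
          (≤-trans (*-monoʳ-≤ failures small) failures-rare)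
      where
      succeeds : Vec Bool coins → Bool
      succeeds w = Returns π x y (dH Σ A B) (prepend w λ _ → false)
      successes : ℕ
      successes = count coins succeeds
      complement : ∀ b → bit b + bit (not b) ≡ 1
      complement true  = refl
      complement false = refl
      failure≡ : ∀ w → failure (tables w) ≡ bit (not (succeeds w))
      failure≡ w = cong₂ (λ v u → wrong v (outputs (protocol (tables u)) x y)) d≡dH (sym (prefix-prepend w _))
      total : successes + failures ≡ 2 ^ coins
      total = begin
        successes + failures
          ≡⟨ cong₂ _+_ (count-∑ coins succeeds) (∑-cong (overBits coins) failure≡) ⟩
        ∑ (overBits coins) (bit ∘ succeeds) + ∑ (overBits coins) (bit ∘ not ∘ succeeds)
          ≡⟨ ∑-+ (overBits coins) _ _ ⟨
        ∑ (overBits coins) (λ w → bit (succeeds w) + bit (not (succeeds w)))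
          ≡⟨ ∑-cong (overBits coins) (complement ∘ succeeds) ⟩
        card (overBits coins)
          ≡⟨ card-overBits coins ⟩
        2 ^ coins ∎
        where open ≡-Reasoning

    open Instance (normalise Σ A B)

    d≤D : d ≤ D
    d≤D = subst (_≤ D) (sym d≡dH) dH≤D

    module _ (ω : Coins) where
      open ≤-Reasoning

      ρ η : Functions
      ρ = functions (proj₁ (tables (prefix coins ω)))
      η = functions (proj₂ (tables (prefix coins ω)))

      few-rounds : rounds (π ω) x y ≤ roundFactor T * roundBound Σ A B
      few-rounds with Behaviour.Cost.attempt-cost ρ η x y (length ∘ derun _≟ᴾ_) (const 2) rounds-block D d≤D ν 0
                        (≤-trans 1≤D (m≤m+n D _))
      ... | k , 2^k≤2D , cost = begin
        rounds (π ω) x y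
          ≤⟨ m≤n+m _ _ ⟩
        T * 0 + rounds (π ω) x y
          ≤⟨ cost ⟩
        T * ∑< (suc k) (const 2) + (T * ∑< (suc (T + k)) (const 2) + 0)
          ≡⟨ cong₂ (λ a b → T * a + (T * b + 0)) (∑<-const (suc k) 2) (∑<-const (suc (T + k)) 2) ⟩
        T * (suc k * 2) + (T * (suc (T + k) * 2) + 0)
          ≤⟨ +-mono-≤ (*-monoʳ-≤ T (*-monoˡ-≤ 2 1+k≤)) (+-monoˡ-≤ 0 (*-monoʳ-≤ T (*-monoˡ-≤ 2 level≤))) ⟩
        T * (2 * D * 2) + (T * ((2 + T) * D * 2) + 0)
          ≡⟨ collect T D ⟩
        roundFactor T * D
          ≤⟨ *-monoʳ-≤ (roundFactor T) (≤-trans (≤-reflexive (sym (*-identityʳ D))) (*-monoʳ-≤ D (1≤lg z))) ⟩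
        roundFactor T * (D * lg z)
          ≡⟨ cong (roundFactor T *_) rounds≡ ⟨
        roundFactor T * roundBound Σ A B ∎
        where
        -- Each level takes at most 2 T rounds, so counting levels is enough; their number is
        -- logarithmic in D, and a linear bound suffices.
        1+k≤ : suc k ≤ 2 * D
        1+k≤ = ≤-trans (1+m≤2^m k) 2^k≤2D
        level≤ : suc (T + k) ≤ (2 + T) * D
        level≤ = begin
          suc (T + k)      ≡⟨ +-suc T k ⟨
          T + suc k        ≤⟨ +-mono-≤ (≤-trans (≤-reflexive (sym (*-identityʳ T))) (*-monoʳ-≤ T 1≤D)) 1+k≤ ⟩
          T * D + 2 * D    ≡⟨ trans (+-comm (T * D) _) (sym (*-distribʳ-+ D 2 T)) ⟩
          (2 + T) * D      ∎
        collect : ∀ t D → t * (2 * D * 2) + (t * ((2 + t) * D * 2) + 0) ≡ t * (4 + (2 + t) * 2) * D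
        collect = solve-∀

      few-bits : bits (π ω) x y ≤ bitFactor T σ * bitBound Σ A B
      few-bits with Behaviour.Cost.attempt-cost ρ η x y length id bits-block D d≤D ν 0
                        (≤-trans 1≤D (m≤m+n D _))
      ... | k , 2^k≤2D , cost = begin
        bits (π ω) x y
          ≤⟨ m≤n+m _ _ ⟩
        T * 0 + bits (π ω) x y
          ≤⟨ cost ⟩
        T * ∑< (suc k) planeBits + (T * ∑< (suc (T + k)) planeBits + 0)
          ≤⟨ +-mono-≤ (*-monoʳ-≤ T (levels-above k 0)) (+-monoˡ-≤ 0 (*-monoʳ-≤ T (levels-above k T))) ⟩
        T * (4 * 1 * C) + (T * (4 * 2 ^ T * C) + 0)
          ≡⟨ collect T (2 ^ T) C ⟩
        T * (4 + 4 * 2 ^ T) * C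
          ≤⟨ *-monoʳ-≤ (T * (4 + 4 * 2 ^ T)) (level-size n D ℓ (7 + σ) k 1≤D n≤D*ℓ 2^k≤2D) ⟩
        T * (4 + 4 * 2 ^ T) * ((4 + 2 * (7 + σ)) * (D * lg ℓ))
          ≡⟨ *-assoc (T * (4 + 4 * 2 ^ T)) _ _ ⟨
        bitFactor T σ * (D * lg ℓ)
          ≡⟨ cong (bitFactor T σ *_) bits≡ ⟨
        bitFactor T σ * bitBound Σ A B ∎
        where
        open LevelCost ν σ using (levels-above)
        C = 2 ^ k * (ν ∸ k + (7 + σ))
        collect : ∀ t p c → t * (4 * 1 * c) + (t * (4 * p * c) + 0) ≡ t * (4 + 4 * p) * c
        collect = solve-∀

theorem2 : ∀ (ε : ℚ) → 0ℚ <ℚ ε → ε <ℚ ½ →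
    ∃[ c ] ∀ (Σ : Alphabet) (n : ℕ) →
    Σ[ π ∈ PublicCoinProtocol (Encoding Σ) (Encoding Σ) ℕ ]
    ∀ (A B : Word Σ n) →
    Pr[ Returns π (LZN Σ A) (LZN Σ B) (dH Σ A B) ]≥ (1ℚ - ε)
    × (∀ (ω : Coins) →
    rounds (π ω) (LZN Σ A) (LZN Σ B) ≤ c * roundBound Σ A B
    × bits (π ω) (LZN Σ A) (LZN Σ B) ≤ c * bitBound Σ A B)
theorem2 ε 0<ε _ = roundFactor T + bitFactor T σ , λ Σ n → Solution.π e T σ refl refl Σ n , λ A B →
    Solution.correct e T σ refl refl Σ n A B ε 0<ε (m≤2^m e) , λ ω →
    ≤-trans (Solution.few-rounds e T σ refl refl Σ n A B ω)
        (*-monoˡ-≤ (roundBound Σ A B) (m≤m+n (roundFactor T) (bitFactor T σ))) ,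
    ≤-trans (Solution.few-bits e T σ refl refl Σ n A B ω)
        (*-monoˡ-≤ (bitBound Σ A B) (m≤n+m (bitFactor T σ) (roundFactor T)))
  where
  -- The denominator is at most 2 ^ e, so the failure probability 2 ^ (- e) is at most its
  -- reciprocal and hence at most ε.
  e = ℚ.↧ₙ ε
  T = 2 + suc e
  σ = T + 2 + suc e
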